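{- For a word $u$ of length $n$, the seed array $\mathsf{Seed}[1..n]$, where $\mathsf{Seed}[i]$ is the length of the shortest seed of the prefix $u[1..i]$, can be computed in $O(n^2)$ time.
   Context: Words are over a finite alphabet. A word $s$ covers $w$ if every position of $w$ lies in some occurrence of $s$ as a factor of $w$. A seed of a word $x$ is a factor $s$ of $x$ such that $x$ is a factor of some word covered by $s$. -}

module Defs where

open import Data.Bool using (Bool; true; false; if_then_else_)
open import Data.Fin using (Fin; toℕ)
open import Data.List using (List; []; _∷_; _++_; length; map; take)
open import Data.Nat using (ℕ; zero; suc; _+_; _*_; _∸_; _^_; _≤_; _<_; _≡ᵇ_; _<ᵇ_)
open import Data.Nat.Logarithm using (⌊log₂_⌋)
open import Data.Product using (_×_; ∃-syntax)
open import Relation.Binary.PropositionalEquality using (_≡_)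

------------------------------------------------------------------------
-- Words and seeds

Word : ℕ → Set
Word σ = List (Fin σ)

-- Positions are counted from 0 here.
OccursAt : ∀ {σ} → Word σ → Word σ → ℕ → Set
OccursAt s w i = ∃[ l ] ∃[ r ] (w ≡ l ++ s ++ r × length l ≡ i)

Factor : ∀ {σ} → Word σ → Word σ → Set
Factor s w = ∃[ i ] OccursAt s w i

Covers : ∀ {σ} → Word σ → Word σ → Set
Covers s w = ∀ k → k < length w →
  ∃[ i ] (OccursAt s w i × i ≤ k × k < i + length s)

Seed : ∀ {σ} → Word σ → Word σ → Set
Seed s x = Factor s x × ∃[ w ] (Covers s w × Factor x w)

IsShortestSeedLength : ∀ {σ} → Word σ → ℕ → Set
IsShortestSeedLength x m =
  (∃[ s ] (Seed s x × length s ≡ m)) × (∀ s → Seed s x → m ≤ length s)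

-- Only the entries 1 , … , length u of the array are constrained.
IsSeedArray : ∀ {σ} → Word σ → (ℕ → ℕ) → Set
IsSeedArray u seed =
  ∀ i → 1 ≤ i → i ≤ length u → IsShortestSeedLength (take i u) (seed i)

------------------------------------------------------------------------
-- Model of computation: structured programs over a unit-cost word RAM.
-- A program mentions finitely many registers and finitely many arrays,
-- each addressed by a literal number.

data Expr : Set where
  lit           : ℕ → Expr
  reg           : ℕ → Expr
  arr           : ℕ → Expr → Expr
  _⊕_ _⊖_ _⊗_   : Expr → Expr → Expr

data Test : Set where
  _≺_ _≈_ : Expr → Expr → Test

data Program : Set where
  skip    : Program
  _≔_     : ℕ → Expr → Program
  _[_]≔_  : ℕ → Expr → Expr → Program
  _⨾_     : Program → Program → Program
  if      : Test → Program → Program → Program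
  while   : Test → Program → Program

record State : Set where
  constructor state
  field
    regs : ℕ → ℕ
    arrs : ℕ → ℕ → ℕ

open State public

update : {A : Set} → (ℕ → A) → ℕ → A → ℕ → A
update f k v j = if j ≡ᵇ k then v else f j

setReg : State → ℕ → ℕ → State
setReg s x v = state (update (regs s) x v) (arrs s)

setArr : State → ℕ → ℕ → ℕ → State
setArr s a i v = state (regs s) (update (arrs s) a (update (arrs s a) i v))

⟦_⟧ : Expr → State → ℕ
⟦ lit k ⟧   s = k
⟦ reg x ⟧   s = regs s x
⟦ arr a e ⟧ s = arrs s a (⟦ e ⟧ s)
⟦ e ⊕ f ⟧   s = ⟦ e ⟧ s + ⟦ f ⟧ s
⟦ e ⊖ f ⟧   s = ⟦ e ⟧ s ∸ ⟦ f ⟧ s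
⟦ e ⊗ f ⟧   s = ⟦ e ⟧ s * ⟦ f ⟧ s

⟦_⟧ᵗ : Test → State → Bool
⟦ e ≺ f ⟧ᵗ s = ⟦ e ⟧ s <ᵇ ⟦ f ⟧ s
⟦ e ≈ f ⟧ᵗ s = ⟦ e ⟧ s ≡ᵇ ⟦ f ⟧ s

-- Every literal, address and (intermediate) value is a w-bit number, so
-- the unit-cost operations never act on numbers longer than a word.
Fits : ℕ → Expr → State → Set
Fits w (lit k)   s = k < 2 ^ w
Fits w (reg x)   s = regs s x < 2 ^ w
Fits w (arr a e) s = Fits w e s × ⟦ arr a e ⟧ s < 2 ^ w
Fits w (e ⊕ f)   s = Fits w e s × Fits w f s × ⟦ e ⊕ f ⟧ s < 2 ^ w
Fits w (e ⊖ f)   s = Fits w e s × Fits w f s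
Fits w (e ⊗ f)   s = Fits w e s × Fits w f s × ⟦ e ⊗ f ⟧ s < 2 ^ w

Fitsᵗ : ℕ → Test → State → Set
Fitsᵗ w (e ≺ f) s = Fits w e s × Fits w f s
Fitsᵗ w (e ≈ f) s = Fits w e s × Fits w f s

cost : Expr → ℕ
cost (lit k)   = 1
cost (reg x)   = 1
cost (arr a e) = 1 + cost e
cost (e ⊕ f)   = 1 + cost e + cost f
cost (e ⊖ f)   = 1 + cost e + cost f
cost (e ⊗ f)   = 1 + cost e + cost f

costᵗ : Test → ℕ
costᵗ (e ≺ f) = 1 + cost e + cost f
costᵗ (e ≈ f) = 1 + cost e + cost f

-- w ⊢ p , s ⇓[ t ] s′ : on a machine with w-bit words, p started in s
-- halts in s′ after t steps.  A run that overflows a word has no derivation.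
data _⊢_,_⇓[_]_ (w : ℕ) : Program → State → ℕ → State → Set where

  skip : ∀ {s} → w ⊢ skip , s ⇓[ 1 ] s

  assign : ∀ {s x e} → Fits w e s →
    w ⊢ x ≔ e , s ⇓[ 1 + cost e ] setReg s x (⟦ e ⟧ s)

  store : ∀ {s a e f} → Fits w e s → Fits w f s →
    w ⊢ a [ e ]≔ f , s ⇓[ 1 + cost e + cost f ] setArr s a (⟦ e ⟧ s) (⟦ f ⟧ s)

  seq : ∀ {s s′ s″ p q t t′} →
    w ⊢ p , s ⇓[ t ] s′ → w ⊢ q , s′ ⇓[ t′ ] s″ →
    w ⊢ p ⨾ q , s ⇓[ t + t′ ] s″

  if-true : ∀ {s s′ b p q t} → Fitsᵗ w b s → ⟦ b ⟧ᵗ s ≡ true →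
    w ⊢ p , s ⇓[ t ] s′ →
    w ⊢ if b p q , s ⇓[ costᵗ b + t ] s′

  if-false : ∀ {s s′ b p q t} → Fitsᵗ w b s → ⟦ b ⟧ᵗ s ≡ false →
    w ⊢ q , s ⇓[ t ] s′ →
    w ⊢ if b p q , s ⇓[ costᵗ b + t ] s′

  while-true : ∀ {s s′ s″ b p t t′} → Fitsᵗ w b s → ⟦ b ⟧ᵗ s ≡ true →
    w ⊢ p , s ⇓[ t ] s′ → w ⊢ while b p , s′ ⇓[ t′ ] s″ →
    w ⊢ while b p , s ⇓[ costᵗ b + (t + t′) ] s″

  while-false : ∀ {s b p} → Fitsᵗ w b s → ⟦ b ⟧ᵗ s ≡ false →
    w ⊢ while b p , s ⇓[ costᵗ b ] s

------------------------------------------------------------------------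
-- Computability within an asymptotic time bound

O : (ℕ → ℕ) → (ℕ → ℕ) → Set
O g f = ∃[ c ] ∃[ n₀ ] (∀ n → n₀ ≤ n → f n ≤ c * g n)

-- One program serves inputs of every size; as usual for the word RAM,
-- words have logarithmically many bits in the input size.
ComputableInTime : (ℕ → ℕ) → {A : Set} → (size : A → ℕ) →
                   (input : A → State) → (Correct : A → State → Set) → Set
ComputableInTime g {A} size input Correct =
  ∃[ p ] ∃[ T ] ∃[ w ] (O g T × O ⌊log₂_⌋ w ×
    ((a : A) → ∃[ t ] ∃[ s ]
      (w (size a) ⊢ p , input a ⇓[ t ] s × t ≤ T (size a) × Correct a s)))

nth : List ℕ → ℕ → ℕ
nth []       _       = 0
nth (x ∷ _)  zero    = x
nth (_ ∷ xs) (suc i) = nth xs i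

-- Register 0 holds the length of u and array 0 holds the letters of u at
-- the indices 1 , … , length u; everything else is 0.
wordInput : ∀ {σ} → Word σ → State
wordInput u = state (update (λ _ → 0) 0 (length u))
                    (update (λ _ _ → 0) 0 (nth (0 ∷ map toℕ u)))

-- The result is read from array 1.
HoldsSeedArray : ∀ {σ} → Word σ → State → Set
HoldsSeedArray u s = IsSeedArray u (arrs s 1)

infix  4 _⊢_,_⇓[_]_
infixr 5 _⨾_
infix  6 _≔_ _[_]≔_
infix  6 _≺_ _≈_
infixl 7 _⊕_ _⊖_
infixl 8 _⊗_

{-# OPTIONS --safe #-}

-- An occurrence of s at p, of length m, reaches back to the beginning of the
-- word with an overhang iff u[0..p+m) has a period at most m, or an earlier
-- occurrence at distance at most m does; likewise, it covers the rest of the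
-- prefix u[0..i) iff u[p..i) has a period at most m.  Hence u[0..i) has a seed
-- of length m iff some p satisfies both conditions with p + m ≤ i.
--
-- A quadratic table records how far the segment at p keeps period d.  From it,
-- for each p, one joint pass over m and the distance d of the nearest previous
-- occurrence of u[p..p+m) (which only grows with m) decides the first condition
-- and computes the largest i admitted by the second.  The maximum of these i
-- over all p ≤ i - m decides the existence of a seed of length m of u[0..i).
-- Since m = i - p decreases as p grows, the last length recorded for i is the
-- shortest.
module Submission where

open import Defs
open import Data.Bool using (true; false; T)
open import Data.Empty using (⊥)
open import Data.Fin using (toℕ)
open import Data.Fin.Properties using (toℕ-injective; toℕ<n)
open import Data.List using ([]; _∷_; _++_; length; map; take; drop)
open import Data.List.Properties using (length-++; length-take; length-drop; ++-assoc; ++-identityʳ; drop-drop; take-[])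
open import Data.Nat
open import Data.Nat.Logarithm using (⌊log₂_⌋; ⌊log₂⌋-mono-≤; ⌊log₂[2^n]⌋≡n)
open import Data.Nat.Properties
open import Data.Nat.Tactic.RingSolver using (solve-∀)
open import Data.Product using (_×_; _,_; proj₁; proj₂; ∃-syntax)
open import Data.Sum using (_⊎_; inj₁; inj₂; [_,_]′)
open import Data.Unit using (tt)
open import Function using (_∘_; _⇔_; mk⇔; Equivalence)
open import Relation.Binary.PropositionalEquality
open import Relation.Nullary using (¬_; contradiction; yes; no)
open Equivalence using (to; from)

-- Running loop-free programs and loops with a time bound

<ᵇ-true : ∀ {m n} → (m <ᵇ n) ≡ true → m < n
<ᵇ-true {m} {n} eq = <ᵇ⇒< m n (subst T (sym eq) tt)

<ᵇ-false : ∀ {m n} → (m <ᵇ n) ≡ false → n ≤ m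
<ᵇ-false eq = ≮⇒≥ λ m<n → subst T eq (<⇒<ᵇ m<n)

≡ᵇ-true : ∀ {m n} → (m ≡ᵇ n) ≡ true → m ≡ n
≡ᵇ-true {m} {n} eq = ≡ᵇ⇒≡ m n (subst T (sym eq) tt)

≡ᵇ-false : ∀ {m n} → (m ≡ᵇ n) ≡ false → m ≢ n
≡ᵇ-false {m} {n} eq m≡n = subst T eq (≡⇒≡ᵇ m n m≡n)

update-elim : ∀ {A : Set} (P : A → Set) (f : ℕ → A) k v j →
  (j ≡ k → P v) → (j ≢ k → P (f j)) → P (update f k v j)
update-elim P f k v j hit miss with j ≡ᵇ k in eq
... | true  = hit (≡ᵇ-true eq)
... | false = miss (≡ᵇ-false eq)

-- Chosen so that ⟦ e ⟧ s ≤ B ^ size e whenever registers and array entries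
-- are at most B ≥ 2.
size : Expr → ℕ
size (lit k)   = suc k
size (reg x)   = 1
size (arr a e) = suc (size e)
size (e ⊕ f)   = suc (size e + size f)
size (e ⊖ f)   = suc (size e + size f)
size (e ⊗ f)   = suc (size e + size f)

sizeᵗ : Test → ℕ
sizeᵗ (e ≺ f) = size e + size f
sizeᵗ (e ≈ f) = size e + size f

sizeᵖ : Program → ℕ
sizeᵖ skip         = 0
sizeᵖ (x ≔ e)      = size e
sizeᵖ (a [ e ]≔ f) = size e + size f
sizeᵖ (p ⨾ q)      = sizeᵖ p + sizeᵖ q
sizeᵖ (if b p q)   = sizeᵗ b + (sizeᵖ p + sizeᵖ q)
sizeᵖ (while b p)  = sizeᵗ b + sizeᵖ p

-- Step count of a loop-free program, with the longer branch charged at `if`. The 0 at `while` is a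
-- default: `wp` admits no loop, and `triple-while` accounts for their time.
time : Program → ℕ
time skip         = 1
time (x ≔ e)      = 1 + cost e
time (a [ e ]≔ f) = 1 + cost e + cost f
time (p ⨾ q)      = time p + time q
time (if b p q)   = costᵗ b + (time p ⊔ time q)
time (while b p)  = 0

-- `B` bounds all stored values and `K` the sizes of the loop-free pieces; `B ^ K < 2 ^ w` then
-- makes every intermediate value fit into a word.
module RAM (w K B : ℕ) (2≤B : 2 ≤ B) (B^K<2^w : B ^ K < 2 ^ w) where

  private
    instance
      B≢0 : NonZero B
      B≢0 = >-nonZero (≤-trans (s≤s z≤n) 2≤B)

  Bounded : State → Set
  Bounded s = (∀ x → regs s x ≤ B) × (∀ a i → arrs s a i ≤ B)

  setReg-bounded : ∀ {s x v} → Bounded s → v ≤ B → Bounded (setReg s x v)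
  setReg-bounded {s} {x} {v} (rs , as) v≤B =
    (λ y → update-elim (_≤ B) (regs s) x v y (λ _ → v≤B) (λ _ → rs y)) , as

  setArr-bounded : ∀ {s a i v} → Bounded s → v ≤ B → Bounded (setArr s a i v)
  setArr-bounded {s} {a} {i} {v} (rs , as) v≤B = rs , λ b j →
    update-elim (λ g → g j ≤ B) (arrs s) a (update (arrs s a) i v) b
      (λ _ → update-elim (_≤ B) (arrs s a) i v j (λ _ → v≤B) (λ _ → as a j)) (λ _ → as b j)

  ^-mono : ∀ {m n} → m ≤ n → B ^ m ≤ B ^ n
  ^-mono = ^-monoʳ-≤ B

  ≤B⇒≤^ : ∀ {v} n → v ≤ B → v ≤ B ^ suc n
  ≤B⇒≤^ n v≤B = ≤-trans v≤B (≤-trans (≤-reflexive (sym (^-identityʳ B))) (^-mono (s≤s (z≤n {n}))))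

  -- A sum of two values at most `B ^ k` is at most `2 * B ^ k`, hence at most `B ^ suc k`; a
  -- product adds the exponents.
  value≤ : ∀ {s} → Bounded s → ∀ e → ⟦ e ⟧ s ≤ B ^ size e
  value≤ _ (lit k) = <⇒≤ (k<B^suc k)
    where
    k<B^suc : ∀ k → k < B ^ suc k
    k<B^suc zero    = subst (0 <_) (sym (^-identityʳ B)) (≤-trans (s≤s z≤n) 2≤B)
    k<B^suc (suc k) = ≤-trans (+-mono-≤ (m^n>0 B (suc k)) (k<B^suc k))
      (≤-trans (≤-reflexive (cong (B ^ suc k +_) (sym (+-identityʳ _)))) (*-monoˡ-≤ (B ^ suc k) 2≤B))
  value≤ bd (reg x) = ≤B⇒≤^ 0 (proj₁ bd x)
  value≤ bd (arr a e) = ≤B⇒≤^ (size e) (proj₂ bd a _)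
  value≤ bd (e ⊕ f) = ≤-trans (+-mono-≤
      (≤-trans (value≤ bd e) (^-mono (m≤m+n (size e) (size f))))
      (≤-trans (value≤ bd f) (^-mono (m≤n+m (size f) (size e)))))
    (≤-trans (≤-reflexive (cong (B ^ (size e + size f) +_) (sym (+-identityʳ _))))
      (*-monoˡ-≤ (B ^ (size e + size f)) 2≤B))
  value≤ {s} bd (e ⊖ f) = ≤-trans (m∸n≤m (⟦ e ⟧ s) (⟦ f ⟧ s)) (≤-trans (value≤ bd e)
    (^-mono (m≤n⇒m≤1+n (m≤m+n (size e) (size f)))))
  value≤ bd (e ⊗ f) = ≤-trans (*-mono-≤ (value≤ bd e) (value≤ bd f))
    (≤-trans (≤-reflexive (sym (^-distribˡ-+-* B (size e) (size f)))) (^-mono (n≤1+n (size e + size f))))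

  value< : ∀ {s} → Bounded s → ∀ e → size e ≤ K → ⟦ e ⟧ s < 2 ^ w
  value< bd e e≤K = ≤-<-trans (value≤ bd e) (≤-<-trans (^-mono e≤K) B^K<2^w)

  fits : ∀ {s} → Bounded s → ∀ e → size e ≤ K → Fits w e s
  fits bd (lit k) e≤K = value< bd (lit k) e≤K
  fits bd (reg x) e≤K = value< bd (reg x) e≤K
  fits bd (arr a e) e≤K = fits bd e (<⇒≤ e≤K) , value< bd (arr a e) e≤K
  fits bd (e ⊕ f) e≤K = fits bd e (m+n≤o⇒m≤o _ (<⇒≤ e≤K)) ,
    fits bd f (m+n≤o⇒n≤o (size e) (<⇒≤ e≤K)) , value< bd (e ⊕ f) e≤K
  fits bd (e ⊖ f) e≤K = fits bd e (m+n≤o⇒m≤o _ (<⇒≤ e≤K)) ,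
    fits bd f (m+n≤o⇒n≤o (size e) (<⇒≤ e≤K))
  fits bd (e ⊗ f) e≤K = fits bd e (m+n≤o⇒m≤o _ (<⇒≤ e≤K)) ,
    fits bd f (m+n≤o⇒n≤o (size e) (<⇒≤ e≤K)) , value< bd (e ⊗ f) e≤K

  fitsᵗ : ∀ {s} → Bounded s → ∀ b → sizeᵗ b ≤ K → Fitsᵗ w b s
  fitsᵗ bd (e ≺ f) b≤K = fits bd e (m+n≤o⇒m≤o _ b≤K) , fits bd f (m+n≤o⇒n≤o (size e) b≤K)
  fitsᵗ bd (e ≈ f) b≤K = fits bd e (m+n≤o⇒m≤o _ b≤K) , fits bd f (m+n≤o⇒n≤o (size e) b≤K)

  Pred : Set₁
  Pred = State → Set

  -- Weakest preconditions of loop-free programs.  Every value written is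
  -- required to be at most B; by fits nothing else can overflow.
  wp : Program → Pred → Pred
  wp skip         Q s = Q s
  wp (x ≔ e)      Q s = ⟦ e ⟧ s ≤ B × Q (setReg s x (⟦ e ⟧ s))
  wp (a [ e ]≔ f) Q s = ⟦ f ⟧ s ≤ B × Q (setArr s a (⟦ e ⟧ s) (⟦ f ⟧ s))
  wp (p ⨾ q)      Q s = wp p (wp q Q) s
  wp (if b p q)   Q s = (⟦ b ⟧ᵗ s ≡ true → wp p Q s) × (⟦ b ⟧ᵗ s ≡ false → wp q Q s)
  wp (while b p)  Q s = ⊥

  Run : Program → State → ℕ → Pred → Set
  Run p s T Q = ∃[ t ] ∃[ s′ ] (w ⊢ p , s ⇓[ t ] s′ × t ≤ T × Bounded s′ × Q s′)

  Triple : Pred → Program → ℕ → Pred → Set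
  Triple P p T Q = ∀ s → Bounded s → P s → Run p s T Q

  run-wp : ∀ p {Q s} → sizeᵖ p ≤ K → Bounded s → wp p Q s → Run p s (time p) Q
  run-wp skip p≤K bd q = _ , _ , skip , ≤-refl , bd , q
  run-wp (x ≔ e) p≤K bd (v≤B , q) =
    _ , _ , assign (fits bd e p≤K) , ≤-refl , setReg-bounded bd v≤B , q
  run-wp (a [ e ]≔ f) p≤K bd (v≤B , q) =
    _ , _ , store (fits bd e (m+n≤o⇒m≤o _ p≤K)) (fits bd f (m+n≤o⇒n≤o (size e) p≤K)) ,
    ≤-refl , setArr-bounded bd v≤B , q
  run-wp (p ⨾ q) p≤K bd pre
    with t , s′ , r , t≤ , bd′ , mid ← run-wp p (m+n≤o⇒m≤o _ p≤K) bd pre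
    with t′ , s″ , r′ , t′≤ , bd″ , post ← run-wp q (m+n≤o⇒n≤o (sizeᵖ p) p≤K) bd′ mid
    = _ , _ , seq r r′ , +-mono-≤ t≤ t′≤ , bd″ , post
  run-wp (if b p q) {s = s} p≤K bd (pre₁ , pre₂) with ⟦ b ⟧ᵗ s in eq
  ... | true
    with t , s′ , r , t≤ , bd′ , post ←
      run-wp p (m+n≤o⇒m≤o _ (m+n≤o⇒n≤o (sizeᵗ b) p≤K)) bd (pre₁ refl)
    = _ , _ , if-true (fitsᵗ bd b (m+n≤o⇒m≤o _ p≤K)) eq r ,
      +-monoʳ-≤ (costᵗ b) (≤-trans t≤ (m≤m⊔n _ _)) , bd′ , post
  ... | false
    with t , s′ , r , t≤ , bd′ , post ←
      run-wp q (m+n≤o⇒n≤o (sizeᵖ p) (m+n≤o⇒n≤o (sizeᵗ b) p≤K)) bd (pre₂ refl)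
    = _ , _ , if-false (fitsᵗ bd b (m+n≤o⇒m≤o _ p≤K)) eq r ,
      +-monoʳ-≤ (costᵗ b) (≤-trans t≤ (m≤n⊔m (time p) _)) , bd′ , post

  triple-wp : ∀ {P p Q} → sizeᵖ p ≤ K → (∀ s → P s → wp p Q s) → Triple P p (time p) Q
  triple-wp {p = p} p≤K pre s bd Ps = run-wp p p≤K bd (pre s Ps)

  triple-seq : ∀ {P p T Q q T′ R} → Triple P p T Q → Triple Q q T′ R →
    Triple P (p ⨾ q) (T + T′) R
  triple-seq tp tq s bd Ps
    with t , s′ , r , t≤ , bd′ , mid ← tp s bd Ps
    with t′ , s″ , r′ , t′≤ , bd″ , post ← tq s′ bd′ mid
    = _ , _ , seq r r′ , +-mono-≤ t≤ t′≤ , bd″ , post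

  triple-weaken : ∀ {P p T Q Q′} → (∀ s → Q s → Q′ s) → Triple P p T Q → Triple P p T Q′
  triple-weaken g tp s bd Ps
    with t , s′ , r , t≤ , bd′ , post ← tp s bd Ps
    = t , s′ , r , t≤ , bd′ , g s′ post

  -- The variant drops in every iteration, so at most `v` bodies and `v + 1` tests are run. In the
  -- hypothesis on the body, `v` is a ghost variable holding the variant on entry.
  triple-while : ∀ {b p T} (I : Pred) (V : State → ℕ) → sizeᵗ b ≤ K →
    (∀ v → Triple (λ s → I s × ⟦ b ⟧ᵗ s ≡ true × V s ≡ v) p T (λ s → I s × V s < v)) →
    ∀ v → Triple (λ s → I s × V s ≤ v) (while b p) (costᵗ b + v * (costᵗ b + T))
                 (λ s → I s × ⟦ b ⟧ᵗ s ≡ false)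
  triple-while {b} {p} {T} I V b≤K body v s bd (Is , Vs≤v) with ⟦ b ⟧ᵗ s in eq
  triple-while {b} {p} {T} I V b≤K body v s bd (Is , Vs≤v) | false =
    _ , _ , while-false (fitsᵗ bd b b≤K) eq , m≤m+n _ _ , bd , Is , eq
  triple-while {b} {p} {T} I V b≤K body v s bd (Is , Vs≤v) | true
    with t , s′ , r , t≤ , bd′ , Is′ , Vs′< ← body (V s) s bd (Is , eq , refl)
    with v
  ... | zero = contradiction (≤-trans Vs′< Vs≤v) λ ()
  ... | suc v′
    with t′ , s″ , r′ , t′≤ , bd″ , post ←
      triple-while I V b≤K body v′ s′ bd′ (Is′ , s≤s⁻¹ (≤-trans Vs′< Vs≤v))
    = _ , _ , while-true (fitsᵗ bd b b≤K) eq r r′ ,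
      +-monoʳ-≤ (costᵗ b) (≤-trans (+-mono-≤ t≤ t′≤) (≤-reflexive (swap T (costᵗ b) (v′ * (costᵗ b + T))))) , bd″ , post
    where
    swap : ∀ T c x → T + (c + x) ≡ c + T + x
    swap T c x = trans (sym (+-assoc T c x)) (cong (_+ x) (+-comm T c))

-- Seeds in terms of periods

-- The segment is half-open: d is a period of c a … c (b ∸ 1).
Per : (ℕ → ℕ) → ℕ → ℕ → ℕ → Set
Per c d a b = ∀ j → a ≤ j → j + d < b → c j ≡ c (j + d)

-- The strict bound lets a pass over lengths start from the unsatisfiable `m = 1` and admit one
-- further period at a time.
Per< : (ℕ → ℕ) → ℕ → ℕ → ℕ → Set
Per< c m a b = ∃[ d ] (1 ≤ d × d < m × Per c d a b)

per-short : ∀ {c d a b} → b ≤ a + d → Per c d a b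
per-short {d = d} b≤ j a≤j j+d<b =
  contradiction (≤-trans j+d<b b≤) (≤⇒≯ (+-monoˡ-≤ d a≤j))

per-sub : ∀ {c d a a′ b b′} → a ≤ a′ → b′ ≤ b → Per c d a b → Per c d a′ b′
per-sub a≤a′ b′≤b per j a′≤j j+d<b′ = per j (≤-trans a≤a′ a′≤j) (≤-trans j+d<b′ b′≤b)

-- The length-m factor at p covers the prefix of length p + m, up to an
-- overhang to the left of the word.
data LeftCovers (c : ℕ → ℕ) (m : ℕ) : ℕ → Set where
  base : ∀ {p} → Per< c (suc m) 0 (p + m) → LeftCovers c m p
  step : ∀ {p d} → LeftCovers c m p → 1 ≤ d → d ≤ m → Per c d p (p + d + m) →
         LeftCovers c m (p + d)

HasSeed : (ℕ → ℕ) → ℕ → ℕ → Set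
HasSeed c i m = ∃[ p ] (p + m ≤ i × LeftCovers c m p × Per< c (suc m) p i)

leftCovers-0 : ∀ {c m} → 1 ≤ m → LeftCovers c m 0
leftCovers-0 1≤m = base (_ , 1≤m , ≤-refl , per-short ≤-refl)

hasSeed-self : ∀ {c i} → 1 ≤ i → HasSeed c i i
hasSeed-self 1≤i = 0 , ≤-refl , leftCovers-0 1≤i , _ , 1≤i , ≤-refl , per-short ≤-refl

-- c, S and W are the letters of x, of the seed and of the superword in
-- which x sits at offset a.
module _ {c S W : ℕ → ℕ} {a i m : ℕ} (1≤m : 1 ≤ m)
  (x-in-W : ∀ j → j < i → c j ≡ W (a + j))
  (covered : ∀ k → k < i → ∃[ o ] ((∀ t → t < m → S t ≡ W (o + t)) × o ≤ a + k × a + k < o + m))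
  where

  Occ : ℕ → Set
  Occ p = p + m ≤ i × (∀ t → t < m → S t ≡ c (p + t))

  -- Two copies of the same word at distance `d` agree letter by letter. The second copy may be cut
  -- off by the end of the word, which serves occurrences overhanging on the right.
  occ-per : ∀ {p q d} → Occ p → q ≡ p + d → (∀ t → t < m → q + t < i → S t ≡ c (q + t)) →
    ∀ {b} → b ≤ i → b ≤ q + m → Per c d p b
  occ-per {p} {q} {d} (_ , S≡) refl S≡′ {b} b≤i b≤q+m j p≤j j+d<b =
    subst (λ j → c j ≡ c (j + d)) (m+[n∸m]≡n p≤j)
      (trans (sym (S≡ t t<m)) (trans (S≡′ t t<m (subst (_< i) (sym j+d≡) (≤-trans j+d<b b≤i))) (cong c eq)))
    where
    t = j ∸ p
    eq : p + d + t ≡ p + t + d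
    eq = trans (+-assoc p d t) (trans (cong (p +_) (+-comm d t)) (sym (+-assoc p t d)))
    j+d≡ : p + d + t ≡ j + d
    j+d≡ = trans eq (cong (_+ d) (m+[n∸m]≡n p≤j))
    t<m : t < m
    t<m = +-cancelˡ-< (p + d) t m (≤-trans (s≤s (≤-reflexive j+d≡)) (≤-trans j+d<b b≤q+m))

  shift : ∀ {o p} → o ≡ a + p → (∀ t → t < m → S t ≡ W (o + t)) →
    ∀ t → t < m → p + t < i → S t ≡ c (p + t)
  shift {p = p} refl S≡ t t<m p+t<i =
    trans (S≡ t t<m) (trans (cong W (+-assoc a p t)) (sym (x-in-W (p + t) p+t<i)))

  -- Some occurrence covers the letter just before the one at `suc p`. If it starts inside the word,
  -- it is at distance at most `m` and the induction goes on from it. Otherwise it overhangs on the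
  -- left, and comparing it with the occurrence at `suc p` gives a period of the whole prefix. As
  -- the jump back has any length up to `m`, `f` is the induction measure.
  occ-leftCovers : ∀ f p → p ≤ f → Occ p → LeftCovers c m p
  occ-leftCovers _ zero _ _ = leftCovers-0 1≤m
  occ-leftCovers (suc f) (suc p) (s≤s p≤f) occ@(p+m≤i , S≡)
    with o , So , o≤ , <o+m ← covered p (≤-trans (s≤s (m≤m+n p m)) p+m≤i)
    with ≤-total a o
  ... | inj₁ a≤o = subst (LeftCovers c m) p′+d≡ (step (occ-leftCovers f p′ (≤-trans p′≤p p≤f) occ′)
          (m<n⇒0<n∸m (s≤s p′≤p)) d≤m
          (occ-per occ′ (sym p′+d≡) (λ t t<m _ → S≡ t t<m) (subst (λ q → q + m ≤ i) (sym p′+d≡) p+m≤i)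
            (≤-reflexive (cong (_+ m) p′+d≡))))
    where
    p′ = o ∸ a
    o≡ : o ≡ a + p′
    o≡ = sym (m+[n∸m]≡n a≤o)
    p′≤p : p′ ≤ p
    p′≤p = +-cancelˡ-≤ a p′ p (subst (_≤ a + p) o≡ o≤)
    d = suc p ∸ p′
    p′+d≡ : p′ + d ≡ suc p
    p′+d≡ = m+[n∸m]≡n (m≤n⇒m≤1+n p′≤p)
    p<p′+m : p < p′ + m
    p<p′+m = +-cancelˡ-< a p (p′ + m) (subst (a + p <_) (trans (cong (_+ m) o≡) (+-assoc a p′ m)) <o+m)
    d≤m : d ≤ m
    d≤m = +-cancelˡ-≤ p′ d m (subst (_≤ p′ + m) (sym p′+d≡) p<p′+m)
    p′+m≤i : p′ + m ≤ i
    p′+m≤i = ≤-trans (+-monoˡ-≤ m (m≤n⇒m≤1+n p′≤p)) p+m≤i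
    occ′ : Occ p′
    occ′ = p′+m≤i , λ t t<m → shift o≡ So t t<m (≤-trans (+-monoʳ-< p′ t<m) p′+m≤i)
  ... | inj₂ o≤a = base (d , m≤n+m 1 g′ , s≤s d≤m , per)
    where
    g = a ∸ o
    g′ = g + p
    d = g′ + 1
    a≡ : o + g ≡ a
    a≡ = m+[n∸m]≡n o≤a
    d≤m : d ≤ m
    d≤m = subst (_≤ m) (+-comm 1 g′) (+-cancelˡ-< o g′ m
      (subst (_< o + m) (trans (cong (_+ p) (sym a≡)) (+-assoc o g p)) <o+m))
    per : Per c d 0 (suc p + m)
    per j _ j+d< = trans (x-in-W j (≤-trans (s≤s (m≤m+n j d)) (≤-trans j+d< p+m≤i)))
      (trans (cong W (trans (cong (_+ j) (sym a≡)) (+-assoc o g j)))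
      (trans (sym (So (g + j) g+j<m))
      (trans (S≡ (g + j) g+j<m) (cong c eq))))
      where
      eq : suc p + (g + j) ≡ j + d
      eq = trans (cong suc (trans (sym (+-assoc p g j)) (cong (_+ j) (+-comm p g))))
             (trans (+-comm (suc g′) j) (cong (j +_) (+-comm 1 g′)))
      g+j<m : g + j < m
      g+j<m = +-cancelˡ-< (suc p) (g + j) m (subst (_< suc p + m) (sym eq) j+d<)

  -- The occurrence covering the letter right after the one at `p` ends later, so it also starts
  -- later, in particular inside the word.
  next-start : ∀ {o p} → o ≤ a + (p + m) → a + (p + m) < o + m →
    ∃[ p′ ] (o ≡ a + p′ × p < p′ × p′ ≤ p + m)
  next-start {o} {p} o≤ <o+m = o ∸ a , sym o≡ ,
    +-cancelˡ-< a _ _ (subst (a + p <_) (sym o≡) a+p<o) ,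
    +-cancelˡ-≤ a _ _ (subst (_≤ a + (p + m)) (sym o≡) o≤)
    where
    a+p<o : a + p < o
    a+p<o = +-cancelʳ-< m (a + p) o (subst (_< o + m) (sym (+-assoc a p m)) <o+m)
    o≡ : a + (o ∸ a) ≡ o
    o≡ = m+[n∸m]≡n (≤-trans (m≤m+n a p) (<⇒≤ a+p<o))

  -- Moves right from a complete occurrence to the next one until the current one ends the word or
  -- the next one overhangs; in the latter case comparing the two gives the period of the remaining
  -- segment. `f` bounds what is still to be covered.
  occ-hasSeed : ∀ f p → i ∸ (p + m) ≤ f → Occ p → HasSeed c i m
  occ-hasSeed f p bound occ@(p+m≤i , S≡) with m≤n⇒m<n∨m≡n p+m≤i
  -- The occurrence is a suffix, and a segment of length `m` has period `m` vacuously.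
  ... | inj₂ p+m≡i = p , p+m≤i , occ-leftCovers p p ≤-refl occ ,
          m , 1≤m , ≤-refl , per-short (≤-reflexive (sym p+m≡i))
  occ-hasSeed zero p bound occ | inj₁ p+m<i =
    contradiction (m∸n≡0⇒m≤n (n≤0⇒n≡0 bound)) (<⇒≱ p+m<i)
  occ-hasSeed (suc f) p bound occ@(p+m≤i , S≡) | inj₁ p+m<i
    with o , So , o≤ , <o+m ← covered (p + m) p+m<i
    with p′ , o≡ , p<p′ , p′≤p+m ← next-start o≤ <o+m
    with ≤-total (p′ + m) i
  ... | inj₁ p′+m≤i = occ-hasSeed f p′
          (s≤s⁻¹ (≤-trans (∸-monoʳ-< (+-monoˡ-< m p<p′) p′+m≤i) bound))
          (p′+m≤i , λ t t<m → shift o≡ So t t<m (≤-trans (+-monoʳ-< p′ t<m) p′+m≤i))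
  ... | inj₂ i≤p′+m = p , p+m≤i , occ-leftCovers p p ≤-refl occ ,
          p′ ∸ p , m<n⇒0<n∸m p<p′ , s≤s (+-cancelˡ-≤ p _ _ (subst (_≤ p + m) (sym p′≡) p′≤p+m)) ,
          occ-per occ (sym p′≡) (shift o≡ So) ≤-refl i≤p′+m
    where
    p′≡ : p + (p′ ∸ p) ≡ p′
    p′≡ = m+[n∸m]≡n (<⇒≤ p<p′)

-- From periods to words

module _ {σ : ℕ} where

  -- Total, with value 0 past the end. By definition `letter u j` is the entry `suc j` of the input
  -- array, so the program and the words share one function `c`.
  letter : Word σ → ℕ → ℕ
  letter u = nth (map toℕ u)

  letter-++ˡ : ∀ x {y} j → j < length x → letter (x ++ y) j ≡ letter x j
  letter-++ˡ (_ ∷ x) zero    _         = refl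
  letter-++ˡ (_ ∷ x) (suc j) (s≤s j<x) = letter-++ˡ x j j<x

  letter-++ʳ : ∀ x {y} j → letter (x ++ y) (length x + j) ≡ letter y j
  letter-++ʳ []      j = refl
  letter-++ʳ (_ ∷ x) j = letter-++ʳ x j

  word-ext : ∀ x y → length x ≡ length y → (∀ j → j < length x → letter x j ≡ letter y j) → x ≡ y
  word-ext []      []      _  _  = refl
  word-ext (a ∷ x) (b ∷ y) ∣≡∣ eq = cong₂ _∷_ (toℕ-injective (eq 0 (s≤s z≤n)))
    (word-ext x y (suc-injective ∣≡∣) λ j j<x → eq (suc j) (s≤s j<x))

  occursAt-letters : ∀ {s w : Word σ} {i} → OccursAt s w i →
    i + length s ≤ length w × (∀ t → t < length s → letter s t ≡ letter w (i + t))
  occursAt-letters {s} (l , r , refl , refl) =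
    subst (length l + length s ≤_) (sym (trans (length-++ l) (cong (length l +_) (length-++ s))))
      (+-monoʳ-≤ (length l) (m≤m+n (length s) (length r))) ,
    λ t t<s → sym (trans (letter-++ʳ l t) (letter-++ˡ s t t<s))

  occursAt-++ : ∀ {s w y : Word σ} {i} → OccursAt s w i → OccursAt s (w ++ y) i
  occursAt-++ {s} {y = y} (l , r , refl , refl) =
    l , r ++ y , trans (++-assoc l (s ++ r) y) (cong (l ++_) (++-assoc s r y)) , refl

  covers-self : ∀ s → Covers {σ} s s
  covers-self s k k<s = 0 , ([] , [] , sym (++-identityʳ s) , refl) , z≤n , k<s

  -- Old positions keep their occurrences when letters are appended; all new ones lie in the
  -- occurrence at `o`, which leaves no gap after `w` and reaches the end.
  covers-extend : ∀ {s w v y : Word σ} {o} → Covers s w → v ≡ w ++ y → OccursAt s v o →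
    o ≤ length w → length v ≤ o + length s → Covers s v
  covers-extend {w = w} {y = y} cov refl occ o≤w wy≤ k k<wy with k <? length w
  ... | yes k<w with i , occ′ , i≤k , k<i+s ← cov k k<w = i , occursAt-++ {y = y} occ′ , i≤k , k<i+s
  ... | no k≮w = _ , occ , ≤-trans o≤w (≮⇒≥ k≮w) , ≤-trans k<wy wy≤

  factor : Word σ → ℕ → ℕ → Word σ
  factor u a k = take k (drop a u)

  length-factor : ∀ u a k → a + k ≤ length u → length (factor u a k) ≡ k
  length-factor u a k a+k≤u = trans (length-take k (drop a u)) (m≤n⇒m⊓n≡m
    (subst (k ≤_) (sym (length-drop a u))
      (≤-trans (≤-reflexive (sym (m+n∸m≡n a k))) (∸-monoˡ-≤ a a+k≤u))))

  letter-factor : ∀ u a k j → j < k → letter (factor u a k) j ≡ letter u (a + j)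
  letter-factor []      zero    (suc k) j       _         = refl
  letter-factor []      (suc a) (suc k) j       _         = refl
  letter-factor (_ ∷ u) zero    (suc k) zero    _         = refl
  letter-factor (_ ∷ u) zero    (suc k) (suc j) (s≤s j<k) = letter-factor u zero k j j<k
  letter-factor (_ ∷ u) (suc a) k       j       j<k       = letter-factor u a k j j<k

  factor-ext : ∀ u {a b} k → a + k ≤ length u → b + k ≤ length u →
    (∀ j → j < k → letter u (a + j) ≡ letter u (b + j)) → factor u a k ≡ factor u b k
  factor-ext u {a} {b} k a≤ b≤ eq = word-ext _ _
    (trans (length-factor u a k a≤) (sym (length-factor u b k b≤)))
    λ j j< → let j<k = subst (j <_) (length-factor u a k a≤) j< in
      trans (letter-factor u a k j j<k) (trans (eq j j<k) (sym (letter-factor u b k j j<k)))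

  factor-split : ∀ u a k l → factor u a (k + l) ≡ factor u a k ++ factor u (a + k) l
  factor-split u a k l = trans (take-+ k (drop a u))
    (cong (λ v → factor u a k ++ take l v) (drop-drop a k u))
    where
    take-+ : ∀ k v → take (k + l) v ≡ take k v ++ take l (drop k v)
    take-+ zero    v       = refl
    take-+ (suc k) []      = sym (take-[] l)
    take-+ (suc k) (x ∷ v) = cong (x ∷_) (take-+ k v)

  per-factor : ∀ u {d a b} k → Per (letter u) d a b → a + k + d ≤ b → b ≤ length u →
    factor u a k ≡ factor u (a + d) k
  per-factor u {d} {a} {b} k per a+k+d≤b b≤u = factor-ext u k
    (≤-trans (m≤m+n (a + k) d) (≤-trans a+k+d≤b b≤u))
    (≤-trans (≤-reflexive (swap k)) (≤-trans a+k+d≤b b≤u))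
    λ j j<k → trans (per (a + j) (m≤m+n a j)
        (≤-trans (+-monoˡ-< d (+-monoʳ-< a j<k)) a+k+d≤b))
      (cong (letter u) (sym (swap j)))
    where
    swap : ∀ j → a + d + j ≡ a + j + d
    swap j = trans (+-assoc a d j) (trans (cong (a +_) (+-comm d j)) (sym (+-assoc a j d)))


  module _ (u : Word σ) where

    private
      F = factor u

      infixl 6 _⁀_
      -- `z` is the left overhang: `z ⁀ p` is the superword under construction up to position `p` of
      -- `u`.
      _⁀_ : Word σ → ℕ → Word σ
      z ⁀ p = z ++ F 0 p

      length-⁀ : ∀ z {p} → p ≤ length u → length (z ⁀ p) ≡ length z + p
      length-⁀ z {p} p≤u = trans (length-++ z) (cong (length z +_) (length-factor u 0 p p≤u))

      ⁀-split : ∀ z p k → z ⁀ (p + k) ≡ (z ⁀ p) ++ F p k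
      ⁀-split z p k = trans (cong (z ++_) (factor-split u 0 p k)) (sym (++-assoc z (F 0 p) (F p k)))

    LeftCovered : ℕ → ℕ → Set
    LeftCovered m p = ∃[ z ] Covers (F p m) (z ⁀ (p + m))

    -- The period makes the factors at `p` and `p + d` equal, and `d ≤ m` makes them overlap or
    -- touch, so the same overhang works.
    leftCovered-step : ∀ {m p d} → d ≤ m → Per (letter u) d p (p + d + m) → p + d + m ≤ length u →
      LeftCovered m p → LeftCovered m (p + d)
    leftCovered-step {m} {p} {d} d≤m per ≤u (z , cov) = z ,
      covers-extend (subst (λ s → Covers s (z ⁀ (p + m))) s≡ cov)
        (trans (cong (z ⁀_) (sym swap)) (⁀-split z (p + m) d))
        (z ⁀ (p + d) , [] ,
          trans (⁀-split z (p + d) m) (cong ((z ⁀ (p + d)) ++_) (sym (++-identityʳ _))) ,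
          length-⁀ z (≤-trans (m≤m+n (p + d) m) ≤u))
        (subst (length z + (p + d) ≤_) (sym (length-⁀ z pm≤u))
          (+-monoʳ-≤ (length z) (+-monoʳ-≤ p d≤m)))
        (≤-reflexive (trans (length-⁀ z ≤u) (trans (sym (+-assoc (length z) (p + d) m))
          (cong (length z + (p + d) +_) (sym (length-factor u (p + d) m ≤u))))))
      where
      swap : p + m + d ≡ p + d + m
      swap = trans (+-assoc p m d) (trans (cong (p +_) (+-comm m d)) (sym (+-assoc p d m)))
      pm≤u : p + m ≤ length u
      pm≤u = ≤-trans (m≤m+n (p + m) d) (subst (_≤ length u) (sym swap) ≤u)
      s≡ : F p m ≡ F (p + d) m
      s≡ = per-factor u m per (≤-reflexive swap) ≤u

    -- With p + g the period, the seed is u[p..p+g) followed by the prefix of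
    -- length p + h, so a single overhanging occurrence suffices.
    leftCovered-overhang : ∀ p g h → let m = p + g + h in
      Per (letter u) (p + g) 0 (p + m) → p + m ≤ length u → LeftCovered m p
    leftCovered-overhang p g h per ≤u = z ,
      covers-extend (covers-self s)
        (trans (cong (z ⁀_) (eq₂ p g h)) (trans (⁀-split z (p + h) (p + g)) (cong (_++ F (p + h) (p + g)) (sym s≡))))
        (z ⁀ p , [] ,
          trans (⁀-split z p m) (cong ((z ⁀ p) ++_) (sym (++-identityʳ _))) ,
          length-⁀ z (≤-trans (m≤m+n p m) ≤u))
        (≤-trans (≤-reflexive (trans (cong (_+ p) ∣z∣) (+-comm g p)))
          (≤-trans (m≤m+n (p + g) h) (≤-reflexive (sym ∣s∣))))
        (≤-reflexive (trans (length-⁀ z ≤u) (trans (sym (+-assoc (length z) p m))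
          (cong (length z + p +_) (sym ∣s∣)))))
      where
      m = p + g + h
      s = F p m
      z = F p g
      eq₁ : ∀ p g h → p + g + h ≡ g + (p + h)
      eq₁ = solve-∀
      eq₂ : ∀ p g h → p + (p + g + h) ≡ p + h + (p + g)
      eq₂ = solve-∀
      ∣s∣ : length s ≡ m
      ∣s∣ = length-factor u p m ≤u
      ∣z∣ : length z ≡ g
      ∣z∣ = length-factor u p g (≤-trans (+-monoʳ-≤ p (≤-trans (m≤n+m g p) (m≤m+n (p + g) h))) ≤u)
      s≡ : s ≡ z ⁀ (p + h)
      s≡ = trans (cong (F p) (eq₁ p g h)) (trans (factor-split u p g (p + h))
        (cong (z ++_) (sym (per-factor u (p + h) per (≤-reflexive (sym (eq₂ p g h))) ≤u))))

    -- While `p` exceeds the period, the occurrence at `p ∸ d` is one step back and its prefix has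
    -- the same period. Once `p ≤ d`, `leftCovered-overhang` applies.
    leftCovered-per : ∀ f {m p d} → p ≤ f → 1 ≤ d → d ≤ m → Per (letter u) d 0 (p + m) →
      p + m ≤ length u → LeftCovered m p
    leftCovered-per f {m} {p} {d} p≤f 1≤d d≤m per ≤u with p ≤? d
    ... | yes p≤d
        with g , refl ← m≤n⇒∃[o]m+o≡n p≤d
        with h , refl ← m≤n⇒∃[o]m+o≡n d≤m = leftCovered-overhang p g h per ≤u
    leftCovered-per zero p≤f 1≤d d≤m per ≤u | no p≰d = contradiction (≤-trans p≤f z≤n) p≰d
    leftCovered-per (suc f) {m} {p} {d} p≤f 1≤d d≤m per ≤u | no p≰d
        with q , refl ← m≤n⇒∃[o]m+o≡n (≰⇒≥ p≰d) =
      subst (LeftCovered m) (+-comm q d) (leftCovered-step d≤m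
        (per-sub z≤n (≤-reflexive (cong (_+ m) (+-comm q d))) per)
        (subst (λ p → p + m ≤ length u) (+-comm d q) ≤u)
        (leftCovered-per f (s≤s⁻¹ (≤-trans (+-monoˡ-≤ q 1≤d) p≤f)) 1≤d d≤m
          (per-sub z≤n q+m≤ per) (≤-trans q+m≤ ≤u)))
      where
      q+m≤ : q + m ≤ d + q + m
      q+m≤ = +-monoˡ-≤ m (m≤n+m q d)

    leftCovers⇒ : ∀ {m p} → LeftCovers (letter u) m p → p + m ≤ length u → LeftCovered m p
    leftCovers⇒ {p = p} (base (d , 1≤d , d<1+m , per)) ≤u =
      leftCovered-per p ≤-refl 1≤d (s≤s⁻¹ d<1+m) per ≤u
    leftCovers⇒ {m} (step {p} {d} lc _ d≤m per) ≤u = leftCovered-step d≤m per ≤u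
      (leftCovers⇒ lc (≤-trans (+-monoˡ-≤ m (m≤m+n p d)) ≤u))

    -- Here d = f + g is the period, and i = p + m + f.
    rightCovered-overhang : ∀ p f g h → let m = f + g + h ; i = p + m + f in
      Per (letter u) (f + g) p i → i ≤ length u → LeftCovered m p →
      ∃[ w ] (Covers (F p m) w × Factor (take i u) w)
    rightCovered-overhang p f g h per ≤u (z , cov) = v , covers-extend cov v≡₁
        (z ⁀ (p + d) , [] , v≡₂ , length-⁀ z (≤-trans p+d≤ ≤u))
        (subst (length z + (p + d) ≤_) (sym (length-⁀ z (≤-trans (m≤m+n (p + m) f) ≤u)))
          (+-monoʳ-≤ (length z) (+-monoʳ-≤ p (m≤m+n d h))))
        (≤-reflexive (trans (cong length v≡₂) (trans (length-++ (z ⁀ (p + d)))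
          (cong₂ _+_ (length-⁀ z (≤-trans p+d≤ ≤u)) (cong length (++-identityʳ s)))))) ,
      length z , z , r , ++-assoc z (F 0 i) r , refl
      where
      d = f + g
      m = d + h
      i = p + m + f
      s = F p m
      -- The last `g` letters of the seed: appended at `i`, they complete the occurrence that starts
      -- at `p + d`.
      r = F (p + (h + f)) g
      v = (z ⁀ i) ++ r
      p+d≤ : p + d ≤ i
      p+d≤ = ≤-trans (+-monoʳ-≤ p (m≤m+n d h)) (m≤m+n (p + m) f)
      eq₁ : ∀ p f g h → p + (f + g + h) + f ≡ p + (f + g) + (h + f)
      eq₁ = solve-∀
      eq₂ : ∀ p f g h → p + (h + f) + (f + g) ≡ p + (f + g + h) + f
      eq₂ = solve-∀
      eq₃ : ∀ f g h → h + f + g ≡ f + g + h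
      eq₃ = solve-∀
      v≡₁ : v ≡ (z ⁀ (p + m)) ++ (F (p + m) f ++ r)
      v≡₁ = trans (cong (_++ r) (⁀-split z (p + m) f)) (++-assoc (z ⁀ (p + m)) (F (p + m) f) r)
      s≡ : F (p + d) (h + f) ++ r ≡ s
      s≡ = trans (cong (_++ r) (sym (per-factor u (h + f) per (≤-reflexive (eq₂ p f g h)) ≤u)))
        (trans (sym (factor-split u p (h + f) g)) (cong (F p) (eq₃ f g h)))
      v≡₂ : v ≡ (z ⁀ (p + d)) ++ (s ++ [])
      v≡₂ = trans (cong (λ i → (z ⁀ i) ++ r) (eq₁ p f g h))
        (trans (cong (_++ r) (⁀-split z (p + d) (h + f)))
        (trans (++-assoc (z ⁀ (p + d)) (F (p + d) (h + f)) r)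
        (cong ((z ⁀ (p + d)) ++_) (trans s≡ (sym (++-identityʳ s))))))

    -- If more than `d` letters remain after the occurrence, it is replaced by the equal one `d`
    -- further right, which keeps the left side covered. Otherwise one overhanging occurrence
    -- suffices. `k` bounds the number of remaining letters.
    rightCovered-per : ∀ k {p m d i} → i ∸ (p + m) ≤ k → 1 ≤ d → d ≤ m → p + m ≤ i →
      Per (letter u) d p i → i ≤ length u → LeftCovered m p →
      ∃[ w ] (Covers (F p m) w × Factor (take i u) w)
    rightCovered-per k {p} {m} {d} {i} i≤k 1≤d d≤m p+m≤i per ≤u lc
      with f , refl ← m≤n⇒∃[o]m+o≡n p+m≤i with f ≤? d
    ... | yes f≤d
        with g , refl ← m≤n⇒∃[o]m+o≡n f≤d
        with h , refl ← m≤n⇒∃[o]m+o≡n d≤m = rightCovered-overhang p f g h per ≤u lc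
    rightCovered-per zero {p} {m} i≤k 1≤d d≤m p+m≤i per ≤u lc | no f≰d =
      contradiction (≤-trans (≤-reflexive (sym (m+n∸m≡n (p + m) _))) (≤-trans i≤k z≤n)) f≰d
    rightCovered-per (suc k) {p} {m} {d} i≤k 1≤d d≤m p+m≤i per ≤u lc | no f≰d
        with g , refl ← m≤n⇒∃[o]m+o≡n (≰⇒≥ f≰d)
      = let w , cov , fac = rightCovered-per k {p + d} {m} {d} {p + m + (d + g)} bound 1≤d d≤m ≤i
              (per-sub (m≤m+n p d) ≤-refl per) ≤u
              (leftCovered-step d≤m (per-sub ≤-refl ≤i per) (≤-trans ≤i ≤u) lc)
        in w , subst (λ s → Covers s w)
             (sym (per-factor u m per (≤-trans (≤-reflexive swap) ≤i) ≤u)) cov , fac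
      where
      swap : p + m + d ≡ p + d + m
      swap = trans (+-assoc p m d) (trans (cong (p +_) (+-comm m d)) (sym (+-assoc p d m)))
      i≡ : p + m + (d + g) ≡ p + d + m + g
      i≡ = trans (sym (+-assoc (p + m) d g)) (cong (_+ g) swap)
      ≤i : p + d + m ≤ p + m + (d + g)
      ≤i = ≤-trans (m≤m+n (p + d + m) g) (≤-reflexive (sym i≡))
      bound : p + m + (d + g) ∸ (p + d + m) ≤ k
      bound = s≤s⁻¹ (begin
        suc (p + m + (d + g) ∸ (p + d + m)) ≡⟨ cong (λ i → suc (i ∸ (p + d + m))) i≡ ⟩
        suc (p + d + m + g ∸ (p + d + m))   ≡⟨ cong suc (m+n∸m≡n (p + d + m) g) ⟩
        suc g                               ≤⟨ +-monoˡ-≤ g 1≤d ⟩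
        d + g                               ≡⟨ m+n∸m≡n (p + m) (d + g) ⟨
        p + m + (d + g) ∸ (p + m)           ≤⟨ i≤k ⟩
        suc k                               ∎)
        where open ≤-Reasoning

    hasSeed⇒seed : ∀ {i m} → i ≤ length u → HasSeed (letter u) i m →
      ∃[ s ] (Seed s (take i u) × length s ≡ m)
    hasSeed⇒seed {i} {m} i≤u (p , p+m≤i , lc , d , 1≤d , d<1+m , per) =
      F p m , (fac , rightCovered-per (i ∸ (p + m)) ≤-refl 1≤d (s≤s⁻¹ d<1+m) p+m≤i per i≤u
        (leftCovers⇒ lc (≤-trans p+m≤i i≤u))) , length-factor u p m (≤-trans p+m≤i i≤u)
      where
      fac : Factor (F p m) (take i u)
      fac with f , refl ← m≤n⇒∃[o]m+o≡n p+m≤i = p , F 0 p , F (p + m) f ,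
        trans (factor-split u 0 (p + m) f)
          (trans (cong (_++ F (p + m) f) (factor-split u 0 p m)) (++-assoc (F 0 p) _ _)) ,
        length-factor u 0 p (≤-trans (≤-trans (m≤m+n p m) p+m≤i) i≤u)

    seed⇒hasSeed : ∀ {i s} → 1 ≤ i → i ≤ length u → Seed s (take i u) →
      1 ≤ length s × length s ≤ i × HasSeed (letter u) i (length s)
    seed⇒hasSeed {i} {s} 1≤i i≤u ((p , occ) , w , cov , a , x-in-w)
      with p+m≤ , s-in-x ← occursAt-letters occ
      with a+i≤ , x-letters ← occursAt-letters x-in-w
      with ∣x∣ ← length-factor u 0 i i≤u
      rewrite ∣x∣ =
      1≤m , ≤-trans (m≤n+m (length s) p) p+m≤ ,
      occ-hasSeed {S = letter s} {W = letter w} 1≤m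
        (λ j j<i → trans (sym (letter-factor u 0 i j j<i)) (x-letters j j<i))
        covered (i ∸ (p + length s)) p ≤-refl
        (p+m≤ , λ t t<m → trans (s-in-x t t<m)
          (letter-factor u 0 i (p + t) (≤-trans (+-monoʳ-< p t<m) p+m≤)))
      where
      covered : ∀ k → k < i → ∃[ o ] ((∀ t → t < length s → letter s t ≡ letter w (o + t)) ×
        o ≤ a + k × a + k < o + length s)
      covered k k<i with o , occ′ , o≤ , <o+m ← cov (a + k) (≤-trans (+-monoʳ-< a k<i) a+i≤) =
        o , proj₂ (occursAt-letters occ′) , o≤ , <o+m
      -- An empty `s` could not cover the first letter.
      1≤m : 1 ≤ length s
      1≤m with o , _ , o≤ , <o+m ← covered 0 1≤i =
        +-cancelˡ-< o 0 (length s) (≤-<-trans (≤-reflexive (+-identityʳ o)) (≤-<-trans o≤ <o+m))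

-- The tables

-- `x + (y ∸ x)` is the maximum, written in the operations of the machine.
≤-max : ∀ {i} x y → i ≤ x + (y ∸ x) ⇔ (i ≤ x ⊎ i ≤ y)
≤-max {i} x y = mk⇔ split [ (λ i≤x → ≤-trans i≤x (m≤m+n x _)) , (λ i≤y → ≤-trans i≤y (m≤n+m∸n y x)) ]′
  where
  split : i ≤ x + (y ∸ x) → i ≤ x ⊎ i ≤ y
  split i≤ with ≤-total x y
  ... | inj₁ x≤y = inj₂ (subst (i ≤_) (m+[n∸m]≡n x≤y) i≤)
  ... | inj₂ y≤x = inj₁ (subst (i ≤_) (trans (cong (x +_) (m≤n⇒m∸n≡0 y≤x)) (+-identityʳ x)) i≤)

-- Here and below, logic is arithmetic on flags, positive meaning true: `1 ∸_` is negation, `*`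
-- conjunction, `+` disjunction, `1 ∸ (a ∸ b)` the comparison `a ≤ b`, and double negation
-- normalises a flag to 0 or 1.
0<1∸ : ∀ m → 0 < 1 ∸ m ⇔ m ≡ 0
0<1∸ zero    = mk⇔ (λ _ → refl) (λ _ → s≤s z≤n)
0<1∸ (suc m) = mk⇔ (λ 0< → contradiction 0< (subst (λ v → ¬ (0 < v)) (sym (0∸n≡0 m)) λ ())) λ ()

0<≤? : ∀ a b → 0 < 1 ∸ (a ∸ b) ⇔ a ≤ b
0<≤? a b = mk⇔ (m∸n≡0⇒m≤n ∘ to (0<1∸ (a ∸ b))) (from (0<1∸ (a ∸ b)) ∘ m≤n⇒m∸n≡0)

0<* : ∀ a b → 0 < a * b ⇔ (0 < a × 0 < b)
0<* (suc a) (suc b) = mk⇔ (λ _ → s≤s z≤n , s≤s z≤n) (λ _ → s≤s z≤n)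
0<* zero    b       = mk⇔ (λ ()) proj₁
0<* (suc a) zero    = mk⇔ (λ 0< → contradiction (subst (0 <_) (*-zeroʳ a) 0<) λ ()) λ ()

0<+ : ∀ a b → 0 < a + b ⇔ (0 < a ⊎ 0 < b)
0<+ zero    b = mk⇔ inj₂ [ (λ ()) , (λ 0<b → 0<b) ]′
0<+ (suc a) b = mk⇔ (λ _ → inj₁ (s≤s z≤n)) (λ _ → s≤s z≤n)

0<1∸1∸ : ∀ a → 0 < 1 ∸ (1 ∸ a) ⇔ 0 < a
0<1∸1∸ zero    = mk⇔ (λ ()) λ ()
0<1∸1∸ (suc a) = mk⇔ (λ _ → s≤s z≤n) λ _ → subst (λ v → 0 < 1 ∸ v) (sym (0∸n≡0 a)) (s≤s z≤n)

≤-flag* : ∀ {f x i} → f ≤ 1 → 1 ≤ i → i ≤ f * x ⇔ (0 < f × i ≤ x)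
≤-flag* {zero}        _ 1≤i = mk⇔ (λ i≤0 → contradiction (≤-trans 1≤i i≤0) λ ()) λ ()
≤-flag* {suc zero} {x} _ _ =
  mk⇔ (λ i≤x → s≤s z≤n , subst (_ ≤_) (+-identityʳ x) i≤x) (subst (_ ≤_) (sym (+-identityʳ x)) ∘ proj₂)
≤-flag* {suc (suc _)} (s≤s ())

-- Row-major index into a table with rows of length `1 + n`.
cell : ℕ → ℕ → ℕ → ℕ
cell n a b = a * (1 + n) + b

cell-injective : ∀ {n b b′} a a′ → b ≤ n → b′ ≤ n → cell n a b ≡ cell n a′ b′ → a ≡ a′ × b ≡ b′
cell-injective zero zero _ _ eq = refl , eq
cell-injective {n} zero (suc a′) b≤n _ refl =
  contradiction (≤-trans (s≤s (≤-trans (m≤m+n n _) (m≤m+n _ _))) b≤n) (n≮n n)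
cell-injective {n} (suc a) zero _ b′≤n refl =
  contradiction (≤-trans (s≤s (≤-trans (m≤m+n n _) (m≤m+n _ _))) b′≤n) (n≮n n)
cell-injective {n} {b} {b′} (suc a) (suc a′) b≤n b′≤n eq
  with refl , refl ← cell-injective a a′ b≤n b′≤n
    (+-cancelˡ-≡ (suc n) _ _ (trans (sym (+-assoc (suc n) (a * suc n) b))
      (trans eq (+-assoc (suc n) (a′ * suc n) b′)))) = refl , refl

update-cell : ∀ {n} (P : ℕ → Set) f a₀ b₀ v a b → b₀ ≤ n → b ≤ n →
  (a ≡ a₀ → b ≡ b₀ → P v) → (¬ (a ≡ a₀ × b ≡ b₀) → P (f (cell n a b))) →
  P (update f (cell n a₀ b₀) v (cell n a b))
update-cell {n} P f a₀ b₀ v a b b₀≤n b≤n hit miss = update-elim P f (cell n a₀ b₀) v (cell n a b)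
  (λ eq → let a≡ , b≡ = cell-injective a a₀ b≤n b₀≤n eq in hit a≡ b≡)
  (λ neq → miss λ where (refl , refl) → neq refl)

module Tables (n : ℕ) (c : ℕ → ℕ) where

  -- `v` is the furthest end, capped at `n`, up to which period `d` persists from `p`. Being closed
  -- under shortening, the property is determined by this threshold.
  IsRun : ℕ → ℕ → ℕ → Set
  IsRun d p v = v ≤ n × (∀ {b} → b ≤ n → b ≤ v ⇔ Per c d p b)

  isRun-start : ∀ {d p} → n ≤ p + d → IsRun d p n
  isRun-start n≤ = ≤-refl , λ b≤n → mk⇔ (λ _ → per-short (≤-trans b≤n n≤)) (λ _ → b≤n)

  isRun-extend : ∀ {d p v} → c p ≡ c (p + d) → IsRun d (suc p) v → IsRun d p v
  isRun-extend {d} {p} c≡ (v≤n , run) = v≤n , λ b≤n → mk⇔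
    (λ b≤v j p≤j j+d<b → extend (to (run b≤n) b≤v) j p≤j j+d<b)
    (from (run b≤n) ∘ per-sub (n≤1+n p) ≤-refl)
    where
    extend : ∀ {b} → Per c d (suc p) b → Per c d p b
    extend per j p≤j j+d<b with m≤n⇒m<n∨m≡n p≤j
    ... | inj₁ p<j  = per j p<j j+d<b
    ... | inj₂ refl = c≡

  isRun-break : ∀ {d p} → c p ≢ c (p + d) → p + d ≤ n → IsRun d p (p + d)
  isRun-break {d} {p} c≢ p+d≤n = p+d≤n , λ b≤n → mk⇔ per-short
    (λ per → ≮⇒≥ λ p+d<b → c≢ (per p ≤-refl p+d<b))

  -- Filling order: `d` increases, and within a row the position decreases to `q`, because a run is
  -- found from the one starting a position later.
  RunTable : ℕ → ℕ → (ℕ → ℕ) → Set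
  RunTable d q T = ∀ d′ p → 1 ≤ d′ → p + d′ ≤ n → d′ < d ⊎ (d′ ≡ d × q ≤ p) →
    IsRun d′ p (T (cell n d′ p))

  runTable-write : ∀ {d q e T} → IsRun d q e → q ≤ n → RunTable d (suc q) T →
    RunTable d q (update T (cell n d q) e)
  runTable-write {d} {q} {e} {T} run q≤n tab d′ p 1≤d′ p+d′≤n which =
    update-cell (IsRun d′ p) T d q e d′ p q≤n (m+n≤o⇒m≤o p p+d′≤n)
      (λ where refl refl → run)
      (λ new → tab d′ p 1≤d′ p+d′≤n ([ inj₁ , (λ (d′≡d , q≤p) → inj₂ (d′≡d ,
        ≤∧≢⇒< q≤p (λ q≡p → new (d′≡d , sym q≡p)))) ]′ which))

  -- The second phase visits the pairs (a , b) in lexicographic order.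
  Done : ℕ → ℕ → ℕ → ℕ → Set
  Done p m a b = a < p ⊎ (a ≡ p × b < m)

  done-suc : ∀ {p m a b} → Done p m a b → Done p (suc m) a b
  done-suc (inj₁ a<p)         = inj₁ a<p
  done-suc (inj₂ (a≡p , b<m)) = inj₂ (a≡p , m≤n⇒m≤1+n b<m)

  done-suc⁻ : ∀ {p m a b} → Done p (suc m) a b → ¬ (a ≡ p × b ≡ m) → Done p m a b
  done-suc⁻ (inj₁ a<p) _ = inj₁ a<p
  done-suc⁻ (inj₂ (a≡p , b<1+m)) new = inj₂ (a≡p , ≤∧≢⇒< (s≤s⁻¹ b<1+m) (λ b≡m → new (a≡p , b≡m)))

  done-≤ : ∀ {p m a} → a ≤ p → Done p (suc m) a m
  done-≤ a≤p with m≤n⇒m<n∨m≡n a≤p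
  ... | inj₁ a<p = inj₁ a<p
  ... | inj₂ a≡p = inj₂ (a≡p , ≤-refl)

  Entry : (ℕ → ℕ → Set) → (ℕ → ℕ → ℕ → Set) → (ℕ → ℕ) → Set
  Entry D P A = ∀ {a b} → 1 ≤ b → a + b ≤ n → D a b → P a b (A (cell n a b))

  entry-write : ∀ {p m P A v} → m ≤ n → P p m v → Entry (Done p m) P A →
    Entry (Done p (suc m)) P (update A (cell n p m) v)
  entry-write {p} {m} {P} {A} {v} m≤n Pv entry {a} {b} 1≤b a+b≤n done =
    update-cell (P a b) A p m v a b m≤n (m+n≤o⇒n≤o a a+b≤n) (λ where refl refl → Pv)
      (λ new → entry 1≤b a+b≤n (done-suc⁻ done new))

  -- The restriction `1 ≤ i` lets `v = 0` mean that no end qualifies, as at `m = 1`.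
  IsExt : ℕ → ℕ → ℕ → Set
  IsExt m p v = v ≤ n × (∀ {i} → 1 ≤ i → i ≤ n → i ≤ v ⇔ Per< c m p i)

  IsFlag : ℕ → ℕ → ℕ → Set
  IsFlag p m v = 0 < v ⇔ LeftCovers c m p

  -- The condition `a + b ≤ i` of `HasSeed` is not imposed here; it results from the moment at which
  -- `R b` is read, in `hasSeed⇔`.
  Reach : ℕ → ℕ → ℕ → ℕ → Set
  Reach p m b i = ∃[ a ] (a + b ≤ n × Done p m a b × LeftCovers c b a × Per< c (suc b) a i)

  IsReach : ℕ → ℕ → ℕ → ℕ → Set
  IsReach p m b v = v ≤ n × (∀ {i} → 1 ≤ i → i ≤ n → i ≤ v ⇔ Reach p m b i)

  -- Conditional, since an entry of `S` is written only when a seed is found; the value may already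
  -- belong to a seed shorter than `b`.
  IsSeed : ℕ → ℕ → ℕ → Set
  IsSeed i b v = HasSeed c i b → 1 ≤ v × v ≤ b × HasSeed c i v

  record Inv (p m : ℕ) (T E L R S : ℕ → ℕ) : Set where
    field
      runs    : ∀ {d a} → 1 ≤ d → a + d ≤ n → IsRun d a (T (cell n d a))
      exts    : Entry (Done p m) (λ a b → IsExt (suc b) a) E
      flags   : Entry (Done p m) IsFlag L
      reaches : ∀ {b} → 1 ≤ b → b ≤ n → IsReach p m b (R b)
      seeds   : ∀ {a b} → 1 ≤ b → a + b ≤ n → Done p m a b → IsSeed (a + b) b (S (a + b))

  inv-resp : ∀ {p m p′ m′ T E L R S} →
    (∀ {a b} → 1 ≤ b → a + b ≤ n → Done p m a b ⇔ Done p′ m′ a b) →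
    Inv p m T E L R S → Inv p′ m′ T E L R S
  inv-resp done⇔ inv = record
    { runs    = runs
    ; exts    = λ 1≤b ≤n → exts 1≤b ≤n ∘ from (done⇔ 1≤b ≤n)
    ; flags   = λ 1≤b ≤n → flags 1≤b ≤n ∘ from (done⇔ 1≤b ≤n)
    ; reaches = λ 1≤b b≤n → let v≤n , reach = reaches 1≤b b≤n in v≤n , λ 1≤i i≤n → mk⇔
        (λ i≤v → let a , ≤n , done , rest = to (reach 1≤i i≤n) i≤v in
          a , ≤n , to (done⇔ 1≤b ≤n) done , rest)
        (λ (a , ≤n , done , rest) → from (reach 1≤i i≤n) (a , ≤n , from (done⇔ 1≤b ≤n) done , rest))
    ; seeds   = λ 1≤b ≤n → seeds 1≤b ≤n ∘ from (done⇔ 1≤b ≤n)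
    }
    where open Inv inv

  inv-next-row : ∀ {p m T E L R S} → n < p + m → Inv p m T E L R S → Inv (suc p) 1 T E L R S
  inv-next-row {p} {m} n<p+m = inv-resp λ 1≤b a+b≤n → mk⇔
    [ (λ a<p → inj₁ (m≤n⇒m≤1+n a<p)) , (λ (a≡p , _) → inj₁ (s≤s (≤-reflexive a≡p))) ]′
    [ (λ a<1+p → [ inj₁ , (λ { refl → inj₂ (refl ,
        +-cancelˡ-< p _ m (≤-<-trans a+b≤n n<p+m)) }) ]′ (m≤n⇒m<n∨m≡n (s≤s⁻¹ a<1+p)))
    , (λ (_ , b<1) → contradiction (≤-trans b<1 1≤b) (n≮n _)) ]′

  -- No pair precedes `(0 , 1)`, so only `R` has to be initialised, with 0 as the maximum over no
  -- candidates.
  inv-start : ∀ {T E L R S} → RunTable (suc n) (suc n) T → (∀ b → R b ≡ 0) → Inv 0 1 T E L R S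
  inv-start tab R≡0 = record
    { runs    = λ 1≤d a+d≤n → tab _ _ 1≤d a+d≤n (inj₁ (s≤s (m+n≤o⇒n≤o _ a+d≤n)))
    ; exts    = λ 1≤b _ done → contradiction done (none 1≤b)
    ; flags   = λ 1≤b _ done → contradiction done (none 1≤b)
    ; reaches = λ {b} 1≤b _ → subst (IsReach 0 1 b) (sym (R≡0 b)) (z≤n , λ 1≤i _ → mk⇔
        (λ i≤0 → contradiction (≤-trans 1≤i i≤0) λ ())
        (λ (_ , _ , done , _) → contradiction done (none 1≤b)))
    ; seeds   = λ 1≤b _ done → contradiction done (none 1≤b)
    }
    where
    none : ∀ {a b} → 1 ≤ b → ¬ Done 0 1 a b
    none 1≤b (inj₂ (_ , b<1)) = n≮n _ (≤-trans b<1 1≤b)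

  -- p - d is the next candidate for the previous occurrence of u[p..p+m).
  record Scan (p m d x : ℕ) : Set where
    field
      p<n    : p < n
      1≤m    : 1 ≤ m
      p+m≤   : p + m ≤ suc n
      1≤d    : 1 ≤ d
      d≤     : d ≤ suc p
      none   : ∀ {e} → 1 ≤ e → e < d → e ≤ p → ¬ Per c e (p ∸ e) (p + m)
      ext    : IsExt m p x

  scan-start : ∀ {p} → p < n → Scan p 1 1 0
  scan-start {p} p<n = record
    { p<n = p<n ; 1≤m = ≤-refl ; p+m≤ = subst (_≤ suc n) (+-comm 1 p) (m≤n⇒m≤1+n p<n)
    ; 1≤d = ≤-refl ; d≤ = s≤s z≤n
    ; none = λ 1≤e e<1 → contradiction (≤-trans e<1 1≤e) (n≮n _)
    ; ext = z≤n , λ 1≤i _ → mk⇔ (λ i≤0 → contradiction (≤-trans 1≤i i≤0) λ ())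
        (λ (_ , 1≤d , d<1 , _) → contradiction (≤-trans d<1 1≤d) (n≮n _))
    }

  scan-next-d : ∀ {p m d x} → d ≤ p → ¬ Per c d (p ∸ d) (p + m) → Scan p m d x → Scan p m (suc d) x
  scan-next-d d≤p ¬per scan = record
    { Scan scan hiding (1≤d; d≤; none)
    ; 1≤d = s≤s z≤n ; d≤ = s≤s d≤p
    ; none = λ 1≤e e<1+d e≤p → [ (λ e<d → none 1≤e e<d e≤p) , (λ where refl → ¬per) ]′
        (m≤n⇒m<n∨m≡n (s≤s⁻¹ e<1+d))
    }
    where open Scan scan

  -- The occurrence at p - d is the one closest to p, so any other previous
  -- occurrence reaches p through it.
  leftCovers-via-nearest : ∀ {p m d} → (∀ {e} → 1 ≤ e → e < d → e ≤ p → ¬ Per c e (p ∸ e) (p + m)) →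
    (d ≤ p → Per c d (p ∸ d) (p + m)) → LeftCovers c m p →
    Per< c (suc m) 0 (p + m) ⊎ (d ≤ p × d ≤ m × LeftCovers c m (p ∸ d))
  leftCovers-via-nearest none stop (base per) = inj₁ per
  leftCovers-via-nearest {m = m} {d} none stop (step {q} {e} lc 1≤e e≤m per) with d ≤? e
  ... | no d≰e = contradiction (subst (λ a → Per c e a (q + e + m)) (sym (m+n∸n≡m q e)) per)
          (none 1≤e (≰⇒> d≰e) (m≤n+m e q))
  ... | yes d≤e with g , refl ← m≤n⇒∃[o]m+o≡n d≤e =
    inj₂ (d≤p , ≤-trans d≤e e≤m , subst (LeftCovers c m) (sym p∸d≡) (via g e≤m per per-d))
    where
    d≤p : d ≤ q + (d + g)
    d≤p = ≤-trans d≤e (m≤n+m _ q)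
    p∸d≡ : q + (d + g) ∸ d ≡ q + g
    p∸d≡ = trans (+-∸-assoc q d≤e) (cong (q +_) (m+n∸m≡n d g))
    per-d : Per c d (q + g) (q + (d + g) + m)
    per-d = subst (λ a → Per c d a (q + (d + g) + m)) p∸d≡ (stop d≤p)
    via : ∀ g → d + g ≤ m → Per c (d + g) q (q + (d + g) + m) → Per c d (q + g) (q + (d + g) + m) →
      LeftCovers c m (q + g)
    via zero    _   _   _     = subst (LeftCovers c m) (sym (+-identityʳ q)) lc
    -- Both `c j` and `c (j + g)` equal `c (j + g + d)`, by the periods `d + g` and `d`; so `g` is a
    -- period, and a step of length `g` leads from `q` to `q + g`.
    via g@(suc _) e≤m per per-d = step lc (s≤s z≤n) (≤-trans (m≤n+m g d) e≤m) λ j q≤j j+g< →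
      let eq  = trans (+-assoc j g d) (cong (j +_) (+-comm g d))
          end = subst₂ _<_ eq (cong (_+ m) (trans (+-assoc q g d) (cong (q +_) (+-comm g d))))
                  (subst (j + g + d <_) (swap (q + g)) (+-monoˡ-< d j+g<))
      in trans (per j q≤j end) (sym (trans
           (per-d (j + g) (+-monoˡ-≤ g q≤j) (subst (_< q + (d + g) + m) (sym eq) end)) (cong c eq)))
      where
      swap : ∀ a → a + m + d ≡ a + d + m
      swap a = trans (+-assoc a m d) (trans (cong (a +_) (+-comm m d)) (sym (+-assoc a d m)))

  -- `stop` says that the search for the previous occurrence has ended: it is at `p ∸ d`, or
  -- `d = suc p` and there is none. The primed tables are spelled exactly as the program computes
  -- them.
  module Visit {p m d x T E L R S} (inv : Inv p m T E L R S) (scan : Scan p m d x)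
    (p+m≤n : p + m ≤ n) (stop : d ≤ p → p + m ≤ T (cell n d (p ∸ d))) where
    open Inv inv
    open Scan scan

    m≤n : m ≤ n
    m≤n = m+n≤o⇒n≤o p p+m≤n

    1≤p+m : 1 ≤ p + m
    1≤p+m = ≤-trans 1≤m (m≤n+m m p)

    max≤n : ∀ {y z} → y ≤ n → z ≤ n → y + (z ∸ y) ≤ n
    max≤n {y} {z} y≤ z≤ = [ (λ ≤y → ≤-trans ≤y y≤) , (λ ≤z → ≤-trans ≤z z≤) ]′ (to (≤-max y z) ≤-refl)

    x′ = x + (T (cell n m p) ∸ x)
    E′ = update E (cell n p m) x′
    -- Reads: `p + m ≤ E′ m`, or `d ≤ p`, `d ≤ m` and the flag at `p ∸ d` is set. As `cell n 0 m` is
    -- `m`, the first part asks for a period at most `m` of the prefix of length `p + m`. It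
    -- consults `E′` because for `p = 0` that cell has only just been written.
    f  = 1 ∸ (1 ∸ ((1 ∸ ((p + m) ∸ E′ m)) + (1 ∸ (d ∸ p)) * (1 ∸ (d ∸ m)) * L (cell n (p ∸ d) m)))
    L′ = update L (cell n p m) f
    r  = R m + (f * x′ ∸ R m)
    R′ = update R m r

    isExt′ : IsExt (suc m) p x′
    isExt′ with x≤n , ext⇔ ← ext | t≤n , run⇔ ← runs {m} {p} 1≤m p+m≤n =
      max≤n x≤n t≤n , λ 1≤i i≤n → mk⇔
        ([ (λ i≤x → let d , 1≤d , d<m , per = to (ext⇔ 1≤i i≤n) i≤x in d , 1≤d , m≤n⇒m≤1+n d<m , per)
         , (λ i≤t → m , 1≤m , ≤-refl , to (run⇔ i≤n) i≤t) ]′ ∘ to (≤-max x _))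
        (λ (d , 1≤d , d<1+m , per) → from (≤-max x _)
          ([ (λ d<m → inj₁ (from (ext⇔ 1≤i i≤n) (d , 1≤d , d<m , per)))
           , (λ { refl → inj₂ (from (run⇔ i≤n) per) }) ]′ (m≤n⇒m<n∨m≡n (s≤s⁻¹ d<1+m))))

    exts′ : Entry (Done p (suc m)) (λ a b → IsExt (suc b) a) E′
    exts′ = entry-write {P = λ a b → IsExt (suc b) a} {A = E} m≤n isExt′ exts

    base⇔ : p + m ≤ E′ m ⇔ Per< c (suc m) 0 (p + m)
    base⇔ = proj₂ (exts′ {0} 1≤m m≤n (done-≤ z≤n)) 1≤p+m p+m≤n

    f≤1 : f ≤ 1
    f≤1 = m∸n≤m 1 (1 ∸ ((1 ∸ ((p + m) ∸ E′ m)) + (1 ∸ (d ∸ p)) * (1 ∸ (d ∸ m)) * L (cell n (p ∸ d) m)))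

    per-d : d ≤ p → Per c d (p ∸ d) (p + m)
    per-d d≤p = to (proj₂ (runs 1≤d (≤-trans (≤-reflexive (m∸n+n≡m d≤p)) (<⇒≤ p<n))) p+m≤n) (stop d≤p)

    flag-d : d ≤ p → IsFlag (p ∸ d) m (L (cell n (p ∸ d) m))
    flag-d d≤p = flags 1≤m (≤-trans (+-monoˡ-≤ m (m∸n≤m p d)) p+m≤n)
      (inj₁ (∸-monoʳ-< 1≤d d≤p))

    isFlag : IsFlag p m f
    isFlag = mk⇔ (sound ∘ to (0<+ X (Y * Z * V)) ∘ to (0<1∸1∸ (X + Y * Z * V)))
      (from (0<1∸1∸ (X + Y * Z * V)) ∘ from (0<+ X (Y * Z * V)) ∘ complete)
      where
      X = 1 ∸ ((p + m) ∸ E′ m)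
      Y = 1 ∸ (d ∸ p)
      Z = 1 ∸ (d ∸ m)
      V = L (cell n (p ∸ d) m)
      sound : 0 < X ⊎ 0 < Y * Z * V → LeftCovers c m p
      sound (inj₁ 0<X) = base (to base⇔ (to (0<≤? (p + m) (E′ m)) 0<X))
      sound (inj₂ 0<) with 0<YZ , 0<V ← to (0<* (Y * Z) V) 0<
        with 0<Y , 0<Z ← to (0<* Y Z) 0<YZ
        with d≤p ← to (0<≤? d p) 0<Y = subst (LeftCovers c m) (m∸n+n≡m d≤p)
          (step (to (flag-d d≤p) 0<V) 1≤d (to (0<≤? d m) 0<Z)
            (subst (λ q → Per c d (p ∸ d) (q + m)) (sym (m∸n+n≡m d≤p)) (per-d d≤p)))
      complete : LeftCovers c m p → 0 < X ⊎ 0 < Y * Z * V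
      complete lc with leftCovers-via-nearest none per-d lc
      ... | inj₁ per = inj₁ (from (0<≤? (p + m) (E′ m)) (from base⇔ per))
      ... | inj₂ (d≤p , d≤m , lc′) = inj₂ (from (0<* (Y * Z) V)
              (from (0<* Y Z) (from (0<≤? d p) d≤p , from (0<≤? d m) d≤m) , from (flag-d d≤p) lc′))

    flags′ : Entry (Done p (suc m)) IsFlag L′
    flags′ = entry-write {P = IsFlag} {A = L} m≤n isFlag flags

    r≤n : r ≤ n
    r≤n = max≤n (proj₁ (reaches 1≤m m≤n))
      (≤-trans (*-monoˡ-≤ x′ f≤1) (≤-trans (≤-reflexive (+-identityʳ x′)) (proj₁ isExt′)))

    isReach-r : IsReach p (suc m) m r
    isReach-r with _ , reach⇔ ← reaches 1≤m m≤n = r≤n , λ 1≤i i≤n → mk⇔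
      ([ (λ i≤R → let a , ≤n , done , rest = to (reach⇔ 1≤i i≤n) i≤R in a , ≤n , done-suc done , rest)
       , (λ i≤fx → let 0<f , i≤x′ = to (≤-flag* f≤1 1≤i) i≤fx in
           p , p+m≤n , done-≤ ≤-refl , to isFlag 0<f , to (proj₂ isExt′ 1≤i i≤n) i≤x′) ]′
       ∘ to (≤-max (R m) _))
      (λ (a , ≤n , done , lc , per) → from (≤-max (R m) _)
        ([ (λ a<p → inj₁ (from (reach⇔ 1≤i i≤n) (a , ≤n , inj₁ a<p , lc , per)))
         , (λ { (refl , _) → inj₂ (from (≤-flag* f≤1 1≤i)
             (from isFlag lc , from (proj₂ isExt′ 1≤i i≤n) per)) }) ]′ done))

    reaches′ : ∀ {b} → 1 ≤ b → b ≤ n → IsReach p (suc m) b (R′ b)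
    reaches′ {b} 1≤b b≤n = update-elim (IsReach p (suc m) b) R m r b (λ { refl → isReach-r })
      λ b≢m → let v≤n , reach⇔ = reaches 1≤b b≤n in v≤n , λ 1≤i i≤n → mk⇔
        (λ i≤v → let a , ≤n , done , rest = to (reach⇔ 1≤i i≤n) i≤v in a , ≤n , done-suc done , rest)
        (λ (a , ≤n , done , rest) → from (reach⇔ 1≤i i≤n)
          (a , ≤n , done-suc⁻ done (b≢m ∘ proj₂) , rest))

    -- Right after the pair `(p , m)`, the visited starts for length `m` are those with `a ≤ p`,
    -- which is `a + m ≤ i` for `i = p + m`.
    hasSeed⇔ : p + m ≤ R′ m ⇔ HasSeed c (p + m) m
    hasSeed⇔ with _ , reach⇔ ← reaches′ 1≤m m≤n = mk⇔
      (λ ≤R → let a , ≤n , done , rest = to (reach⇔ 1≤p+m p+m≤n) ≤R in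
        a , +-monoˡ-≤ m ([ <⇒≤ , ≤-reflexive ∘ proj₁ ]′ done) , rest)
      (λ (a , a+m≤ , rest) → from (reach⇔ 1≤p+m p+m≤n)
        (a , ≤-trans a+m≤ p+m≤n , done-≤ (+-cancelʳ-≤ m a p a+m≤) , rest))

    inv-next : (S′ : ℕ → ℕ) →
      (∀ {a b} → 1 ≤ b → a + b ≤ n → Done p (suc m) a b → IsSeed (a + b) b (S′ (a + b))) →
      Inv p (suc m) T E′ L′ R′ S′
    inv-next S′ seeds′ = record
      { runs = runs ; exts = exts′ ; flags = flags′ ; reaches = reaches′ ; seeds = seeds′ }

    -- Overwriting is safe: a visited pair with `a + b = p + m` has `a ≤ p`, hence `m ≤ b`.
    inv-record : p + m ≤ R′ m → Inv p (suc m) T E′ L′ R′ (update S (p + m) m)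
    inv-record ≤R = inv-next _ λ {a} {b} 1≤b a+b≤n done →
      update-elim (IsSeed (a + b) b) S (p + m) m (a + b)
        (λ eq _ → 1≤m , ≤-trans (≤-reflexive (sym (m+n∸m≡n p m))) (subst (λ s → s ∸ p ≤ b) eq
            (≤-trans (∸-monoʳ-≤ (a + b) ([ <⇒≤ , ≤-reflexive ∘ proj₁ ]′ done))
              (≤-reflexive (m+n∸m≡n a b)))) ,
          subst (λ i → HasSeed c i m) (sym eq) (to hasSeed⇔ ≤R))
        (λ neq → seeds 1≤b a+b≤n (done-suc⁻ done λ { (refl , refl) → neq refl }))

    inv-skip : R′ m < p + m → Inv p (suc m) T E′ L′ R′ S
    inv-skip R< = inv-next S seeds′
      where
      seeds′ : ∀ {a b} → 1 ≤ b → a + b ≤ n → Done p (suc m) a b → IsSeed (a + b) b (S (a + b))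
      seeds′ 1≤b a+b≤n (inj₁ a<p) = seeds 1≤b a+b≤n (inj₁ a<p)
      seeds′ 1≤b a+b≤n (inj₂ (refl , b<1+m)) with m≤n⇒m<n∨m≡n (s≤s⁻¹ b<1+m)
      ... | inj₁ b<m  = seeds 1≤b a+b≤n (inj₂ (refl , b<m))
      ... | inj₂ refl = λ has → contradiction (from hasSeed⇔ has) (<⇒≱ R<)

    -- `d` need not be reset: a previous occurrence of the longer factor is also one of the shorter
    -- factor.
    scan-next : Scan p (suc m) d x′
    scan-next = record
      { Scan scan hiding (1≤m; p+m≤; none; ext)
      ; 1≤m = s≤s z≤n ; p+m≤ = ≤-trans (≤-reflexive (+-suc p m)) (s≤s p+m≤n)
      ; none = λ 1≤e e<d e≤p per → none 1≤e e<d e≤p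
          (per-sub ≤-refl (+-monoʳ-≤ p (n≤1+n m)) per)
      ; ext = isExt′ }

-- The program

-- Registers: 0 = n, 1 = d, 2 = q, 3 = e, 4 = p, 5 = m, 6 = x, 7 = f.
-- Arrays: 0 = letters, 1 = S, 2 = T, 3 = E, 4 = L, 5 = R, in the notation of
-- Tables.Inv.
at : Expr → Expr → Expr
at a b = a ⊗ (lit 1 ⊕ reg 0) ⊕ b

runTest runRowTest scanTest scanRowTest : Test
runTest     = lit 0 ≺ reg 2
runRowTest  = reg 1 ≺ lit 1 ⊕ reg 0
scanTest    = reg 4 ⊕ reg 5 ≺ lit 1 ⊕ reg 0
scanRowTest = reg 4 ≺ reg 0

runStart runInit runStep runNext runRow runPhase : Program

runStart = 1 ≔ lit 1
-- One past the last position with `q + d ≤ n`, since `runStep` decrements first; the run there is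
-- vacuously `n`.
runInit  = 2 ≔ (lit 1 ⊕ reg 0) ⊖ reg 1 ⨾ 3 ≔ reg 0
runStep  =
  2 ≔ reg 2 ⊖ lit 1 ⨾
  -- Position `q` is stored at index `q + 1`. For `q + d = n` the right side is the default 0 past
  -- the last letter, and both outcomes leave `e = n`.
  if (arr 0 (lit 1 ⊕ reg 2) ≈ arr 0 (lit 1 ⊕ (reg 2 ⊕ reg 1))) skip (3 ≔ reg 2 ⊕ reg 1) ⨾
  2 [ at (reg 1) (reg 2) ]≔ reg 3
runNext  = 1 ≔ lit 1 ⊕ reg 1
runRow   = runInit ⨾ while runTest runStep ⨾ runNext
runPhase = runStart ⨾ while runRowTest runRow

visit scanStart scanInit scanStep scanNext scanRow scanPhase seedArray : Program

visit =
  6 ≔ reg 6 ⊕ (arr 2 (at (reg 5) (reg 4)) ⊖ reg 6) ⨾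
  3 [ at (reg 4) (reg 5) ]≔ reg 6 ⨾
  -- For `d > p` the row index `p ∸ d` truncates to 0, and the value read there is masked by the
  -- factor testing `d ≤ p`.
  7 ≔ lit 1 ⊖ (lit 1 ⊖ ((lit 1 ⊖ ((reg 4 ⊕ reg 5) ⊖ arr 3 (reg 5))) ⊕
        (lit 1 ⊖ (reg 1 ⊖ reg 4)) ⊗ (lit 1 ⊖ (reg 1 ⊖ reg 5)) ⊗ arr 4 (at (reg 4 ⊖ reg 1) (reg 5)))) ⨾
  4 [ at (reg 4) (reg 5) ]≔ reg 7 ⨾
  5 [ reg 5 ]≔ arr 5 (reg 5) ⊕ (reg 7 ⊗ reg 6 ⊖ arr 5 (reg 5)) ⨾
  if (arr 5 (reg 5) ≺ reg 4 ⊕ reg 5) skip (1 [ reg 4 ⊕ reg 5 ]≔ reg 5) ⨾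
  5 ≔ lit 1 ⊕ reg 5

-- The product is positive iff `d ≤ p` and the run of period `d` from `p ∸ d` ends before `p + m`,
-- that is, iff the candidate at distance `d` exists and fails.
scanStep = if (lit 0 ≺ (lit 1 ⊖ (reg 1 ⊖ reg 4)) ⊗ ((reg 4 ⊕ reg 5) ⊖ arr 2 (at (reg 1) (reg 4 ⊖ reg 1))))
  (1 ≔ lit 1 ⊕ reg 1)
  visit

scanStart = 4 ≔ lit 0
scanInit  = 5 ≔ lit 1 ⨾ 1 ≔ lit 1 ⨾ 6 ≔ lit 0
scanNext  = 4 ≔ lit 1 ⊕ reg 4
scanRow   = scanInit ⨾ while scanTest scanStep ⨾ scanNext
scanPhase = scanStart ⨾ while scanRowTest scanRow

seedArray = runPhase ⨾ scanPhase

record RunInv (n : ℕ) (c : ℕ → ℕ) (d q e : ℕ) (T : ℕ → ℕ) : Set where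
  open Tables n c
  field
    1≤d  : 1 ≤ d
    d≤n  : d ≤ n
    q+d≤ : q + d ≤ suc n
    run  : IsRun d q e
    tab  : RunTable d q T

module _ {n d : ℕ} {c T : ℕ → ℕ} where
  open Tables n c

  runInv-extend : ∀ {q e} → 0 < q → c (q ∸ 1) ≡ c (q ∸ 1 + d) → RunInv n c d q e T →
    RunInv n c d (q ∸ 1) e (update T (cell n d (q ∸ 1)) e)
  runInv-extend {suc q} _ c≡ inv = record
    { RunInv inv hiding (q+d≤; run; tab)
    ; q+d≤ = <⇒≤ q+d≤ ; run = run′ ; tab = runTable-write {T = T} run′ (m+n≤o⇒m≤o q (s≤s⁻¹ q+d≤)) tab }
    where
    open RunInv inv
    run′ = isRun-extend c≡ run

  runInv-break : ∀ {q e} → 0 < q → c (q ∸ 1) ≢ c (q ∸ 1 + d) → RunInv n c d q e T →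
    RunInv n c d (q ∸ 1) (q ∸ 1 + d) (update T (cell n d (q ∸ 1)) (q ∸ 1 + d))
  runInv-break {suc q} _ c≢ inv = record
    { RunInv inv hiding (q+d≤; run; tab)
    ; q+d≤ = <⇒≤ q+d≤ ; run = run′ ; tab = runTable-write {T = T} run′ (m+n≤o⇒m≤o q (s≤s⁻¹ q+d≤)) tab }
    where
    open RunInv inv
    run′ = isRun-break c≢ (s≤s⁻¹ q+d≤)

  runInv-start : 1 ≤ d → d ≤ n → RunTable d (suc n) T → RunInv n c d (suc n ∸ d) n T
  runInv-start 1≤d d≤n tab = record
    { 1≤d = 1≤d ; d≤n = d≤n ; q+d≤ = ≤-reflexive q+d≡ ; run = isRun-start (<⇒≤ (≤-reflexive (sym q+d≡)))
    ; tab = λ d′ p 1≤d′ p+d′≤n → tab d′ p 1≤d′ p+d′≤n ∘ [ inj₁ , (λ { (refl , q≤p) →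
        contradiction (≤-trans (≤-reflexive (sym q+d≡)) (≤-trans (+-monoˡ-≤ d q≤p) p+d′≤n)) (n≮n n) }) ]′ }
    where
    q+d≡ : suc n ∸ d + d ≡ suc n
    q+d≡ = m∸n+n≡m (m≤n⇒m≤1+n d≤n)

  runInv-end : ∀ {q e} → q ≤ 0 → RunInv n c d q e T → RunTable (suc d) (suc n) T
  runInv-end z≤n inv _ _ 1≤d′ p+d′≤n (inj₁ d′<1+d) = RunInv.tab inv _ _ 1≤d′ p+d′≤n
    ([ inj₁ , (λ d′≡d → inj₂ (d′≡d , z≤n)) ]′ (m≤n⇒m<n∨m≡n (s≤s⁻¹ d′<1+d)))
  runInv-end z≤n inv _ p 1≤d′ p+d′≤n (inj₂ (_ , n<p)) =
    contradiction (≤-trans n<p (m+n≤o⇒m≤o p p+d′≤n)) (n≮n n)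

-- The sum that `triple-seq` and `triple-while` produce for an initialisation, a loop of variant at
-- most `v`, and a final step.
rowTime : ℕ → ℕ → ℕ → ℕ → ℕ → ℕ
rowTime a b v c e = a + ((b + v * (b + c)) + e)

phaseTime : ℕ → ℕ → ℕ → ℕ → ℕ
phaseTime a b v c = a + (b + v * (b + c))

runRowTime runPhaseTime scanRowTime scanPhaseTime : ℕ → ℕ

runRowTime n = rowTime (time runInit) (costᵗ runTest) (suc n) (time runStep) (time runNext)
runPhaseTime n = phaseTime (time runStart) (costᵗ runRowTest) n (runRowTime n)

scanRowTime n = rowTime (time scanInit) (costᵗ scanTest) (suc n + suc n) (time scanStep) (time scanNext)
scanPhaseTime n = phaseTime (time scanStart) (costᵗ scanRowTest) n (scanRowTime n)

-- At least the size of each loop-free part of the program.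
K : ℕ
K = 200

-- Correctness and running time of the program

module Correctness (w B n : ℕ) (A : ℕ → ℕ) (2≤B : 2 ≤ B) (n<B : n < B) (B^K<2^w : B ^ K < 2 ^ w) where
  open RAM w K B 2≤B B^K<2^w

  ≤K : ∀ {k} {ok : T (k ≤ᵇ K)} → k ≤ K
  ≤K {k} {ok} = ≤ᵇ⇒≤ k K ok

  -- The invariants mention the length and the letters through the state, so
  -- that they reduce along with it; Frame identifies them with the input.
  Frame : State → Set
  Frame s = regs s 0 ≡ n × arrs s 0 ≡ A

  letters : State → ℕ → ℕ
  letters s k = arrs s 0 (suc k)

  module _ {n′ : ℕ} {A′ : ℕ → ℕ} (frame : n′ ≡ n × A′ ≡ A) where

    1+n≤B : ∀ {v} → v ≤ suc n′ → v ≤ B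
    1+n≤B v≤ = ≤-trans (subst (λ n → _ ≤ suc n) (proj₁ frame) v≤) n<B

    n≤B : ∀ {v} → v ≤ n′ → v ≤ B
    n≤B = 1+n≤B ∘ m≤n⇒m≤1+n

  R≡0 : State → Set
  R≡0 s = ∀ b → arrs s 5 b ≡ 0

  1≤B : 1 ≤ B
  1≤B = <⇒≤ 2≤B

  Rows : Pred
  Rows s = Frame s × R≡0 s × 1 ≤ regs s 1 ×
    Tables.RunTable (regs s 0) (letters s) (regs s 1) (suc (regs s 0)) (arrs s 2)

  -- `v` carries the outer variant through the inner loop, so that its decrease can be shown after
  -- `runNext`.
  Row : ℕ → Pred
  Row v s = Frame s × R≡0 s × suc (regs s 0) ∸ regs s 1 ≡ v ×
    RunInv (regs s 0) (letters s) (regs s 1) (regs s 2) (regs s 3) (arrs s 2)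

  runStep-ok : ∀ u v → Triple (λ s → Row u s × ⟦ runTest ⟧ᵗ s ≡ true × regs s 2 ≡ v) runStep
    (time runStep) (λ s → Row u s × regs s 2 < v)
  runStep-ok u v = triple-wp {p = runStep} ≤K λ where
    s ((fr , R0 , V≡ , inv) , test , refl) →
      let open RunInv inv
          0<q = <ᵇ-true test
          <v  = ∸-monoʳ-< {regs s 2} {1} {0} ≤-refl 0<q
          q≤  = ≤-trans (m∸n≤m (regs s 2) 1) (m+n≤o⇒m≤o _ q+d≤)
      in 1+n≤B fr q≤ ,
         (λ eq → let inv′ = runInv-extend 0<q (≡ᵇ-true eq) inv in
           n≤B fr (proj₁ run) , (fr , R0 , V≡ , inv′) , <v) ,
         (λ neq → let inv′ = runInv-break 0<q (≡ᵇ-false neq) inv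
                      e≤B  = n≤B fr (proj₁ (RunInv.run inv′)) in
           e≤B , e≤B , (fr , R0 , V≡ , inv′) , <v)

  rowsLeft : State → ℕ
  rowsLeft s = suc (regs s 0) ∸ regs s 1

  runRow-ok : ∀ v → Triple (λ s → Rows s × ⟦ runRowTest ⟧ᵗ s ≡ true × rowsLeft s ≡ v) runRow
    (runRowTime n) (λ s → Rows s × rowsLeft s < v)
  runRow-ok v = triple-seq {Q = λ s → Row v s × regs s 2 ≤ suc n}
    (triple-wp {p = runInit} ≤K λ where
      s ((fr , R0 , 1≤d , tab) , test , V≡) →
        1+n≤B fr (m∸n≤m (suc (regs s 0)) (regs s 1)) , n≤B fr ≤-refl ,
        (fr , R0 , V≡ , runInv-start 1≤d (s≤s⁻¹ (<ᵇ-true test)) tab) ,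
        subst (λ n → suc (regs s 0) ∸ regs s 1 ≤ suc n) (proj₁ fr) (m∸n≤m (suc (regs s 0)) (regs s 1)))
    (triple-seq (triple-while (Row v) (λ s → regs s 2) ≤K (runStep-ok v) (suc n))
    (triple-wp {p = runNext} ≤K λ where
      s ((fr , R0 , refl , inv) , test) →
        1+n≤B fr (s≤s (RunInv.d≤n inv)) ,
        (fr , R0 , s≤s z≤n , runInv-end (<ᵇ-false test) inv) ,
        ∸-monoʳ-< ≤-refl (s≤s (RunInv.d≤n inv))))

  runPhase-ok : Triple (λ s → Frame s × R≡0 s) runPhase (runPhaseTime n)
    (λ s → Rows s × ⟦ runRowTest ⟧ᵗ s ≡ false)
  runPhase-ok = triple-seq
    (triple-wp {p = runStart} ≤K λ where
      s (fr , R0) → 1≤B , (fr , R0 , ≤-refl , no-rows s) , ≤-reflexive (proj₁ fr))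
    (triple-while Rows rowsLeft ≤K runRow-ok n)
    where
    no-rows : ∀ s → Tables.RunTable (regs s 0) (letters s) 1 (suc (regs s 0)) (arrs s 2)
    no-rows s _ _ 1≤d _ (inj₁ d<1)     = contradiction (≤-trans d<1 1≤d) (n≮n _)
    no-rows s _ p _ p+1≤n (inj₂ (refl , n<p)) =
      contradiction (≤-trans n<p (m+n≤o⇒m≤o _ p+1≤n)) (n≮n (regs s 0))

  Inv : State → ℕ → ℕ → Set
  Inv s p m = Tables.Inv (regs s 0) (letters s) p m (arrs s 2) (arrs s 3) (arrs s 4) (arrs s 5) (arrs s 1)

  Scans : Pred
  Scans s = Frame s × regs s 4 ≤ regs s 0 × Inv s (regs s 4) 1

  Scan : ℕ → Pred
  Scan v s = Frame s × regs s 0 ∸ regs s 4 ≡ v × Inv s (regs s 4) (regs s 5) ×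
    Tables.Scan (regs s 0) (letters s) (regs s 4) (regs s 5) (regs s 1) (regs s 6)

  -- Each step raises `m` or `d` and lowers neither, so a row takes linear time although both are
  -- searched.
  scanLeft : State → ℕ
  scanLeft s = (suc (regs s 0) ∸ (regs s 4 + regs s 5)) + (suc (regs s 4) ∸ regs s 1)

  scanStep-ok : ∀ u v → Triple
    (λ s → Scan u s × ⟦ scanTest ⟧ᵗ s ≡ true × scanLeft s ≡ v) scanStep
    (time scanStep) (λ s → Scan u s × scanLeft s < v)
  scanStep-ok u v = triple-wp {p = scanStep} ≤K λ where
    s ((fr , V≡ , inv , scan) , test , refl) →
      let module Tb = Tables (regs s 0) (letters s)
          open Tb.Scan scan
          open Tb.Inv inv
          n = regs s 0 ; d = regs s 1 ; p = regs s 4 ; m = regs s 5 ; T = arrs s 2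
          p+m≤n = s≤s⁻¹ (<ᵇ-true test)
          factors = 0<* (1 ∸ (d ∸ p)) (p + m ∸ T (cell n d (p ∸ d)))
      in (λ pos →
            let 0<Y , 0<Z = to factors (<ᵇ-true pos)
                d≤p = to (0<≤? d p) 0<Y
                p∸d+d≤n = ≤-trans (≤-reflexive (m∸n+n≡m d≤p)) (<⇒≤ p<n)
            in 1+n≤B fr (s≤s (≤-trans d≤p (<⇒≤ p<n))) ,
               (fr , V≡ , inv , Tb.scan-next-d d≤p (λ per →
                 contradiction (from (proj₂ (runs 1≤d p∸d+d≤n) p+m≤n) per)
                   (<⇒≱ (m∸n≢0⇒n<m (>⇒≢ 0<Z)))) scan) ,
               +-monoʳ-< (suc n ∸ (p + m)) (∸-monoʳ-< ≤-refl (s≤s d≤p))) ,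
         (λ neg →
            let stop = λ d≤p → ≮⇒≥ λ T<p+m →
                  n≮n 0 (≤-trans (from factors (from (0<≤? d p) d≤p , m<n⇒0<n∸m T<p+m)) (<ᵇ-false neg))
                module V = Tb.Visit inv scan p+m≤n stop
                x≤B = n≤B fr (proj₁ V.isExt′)
                m≤B = n≤B fr V.m≤n
                1+m≤B = 1+n≤B fr (s≤s V.m≤n)
                V< = +-monoˡ-< (suc p ∸ d) (∸-monoʳ-< (+-monoʳ-< p ≤-refl)
                       (≤-trans (≤-reflexive (+-suc p m)) (s≤s p+m≤n)))
                f≤B = ≤-trans V.f≤1 1≤B
            in x≤B , x≤B , f≤B , f≤B , n≤B fr V.r≤n ,
               (λ lt → 1+m≤B , (fr , V≡ , V.inv-skip (<ᵇ-true lt) , V.scan-next) , V<) ,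
               (λ ge → m≤B , 1+m≤B , (fr , V≡ , V.inv-record (<ᵇ-false ge) , V.scan-next) , V<))

  scanRowsLeft : State → ℕ
  scanRowsLeft s = regs s 0 ∸ regs s 4

  scanRow-ok : ∀ v → Triple (λ s → Scans s × ⟦ scanRowTest ⟧ᵗ s ≡ true × scanRowsLeft s ≡ v) scanRow
    (scanRowTime n) (λ s → Scans s × scanRowsLeft s < v)
  scanRow-ok v = triple-seq {Q = λ s → Scan v s × scanLeft s ≤ suc n + suc n}
    (triple-wp {p = scanInit} ≤K λ where
      s ((fr , p≤n , inv) , test , V≡) →
        let p<n = <ᵇ-true test in
        1≤B , 1≤B , z≤n ,
        (fr , V≡ , inv , Tables.scan-start (regs s 0) (letters s) p<n) ,
        subst (λ n → scanLeft (setReg (setReg (setReg s 5 1) 1 1) 6 0) ≤ suc n + suc n) (proj₁ fr)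
          (+-mono-≤ (m∸n≤m (suc (regs s 0)) (regs s 4 + 1)) (m≤n⇒m≤1+n p≤n)))
    (triple-seq (triple-while (Scan v) scanLeft ≤K (scanStep-ok v) (suc n + suc n))
    (triple-wp {p = scanNext} ≤K λ where
      s ((fr , refl , inv , scan) , test) →
        let p<n = Tables.Scan.p<n scan in
        n≤B fr p<n ,
        (fr , p<n , Tables.inv-next-row (regs s 0) (letters s) (<ᵇ-false test) inv) ,
        ∸-monoʳ-< ≤-refl p<n))

  scanPhase-ok : Triple (λ s → Rows s × ⟦ runRowTest ⟧ᵗ s ≡ false) scanPhase (scanPhaseTime n)
    (λ s → Scans s × ⟦ scanRowTest ⟧ᵗ s ≡ false)
  scanPhase-ok = triple-seq
    (triple-wp {p = scanStart} ≤K λ where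
      s ((fr , R0 , _ , tab) , test) →
        z≤n , (fr , z≤n , Tables.inv-start (regs s 0) (letters s) (full {c = letters s} {T = arrs s 2} (<ᵇ-false test) tab) R0) ,
        ≤-reflexive (proj₁ fr))
    (triple-while Scans scanRowsLeft ≤K scanRow-ok n)
    where
    full : ∀ {n c d T} → suc n ≤ d → Tables.RunTable n c d (suc n) T →
      Tables.RunTable n c (suc n) (suc n) T
    full n<d tab d′ p 1≤d′ p+d′≤n _ = tab d′ p 1≤d′ p+d′≤n
      (inj₁ (≤-trans (s≤s (m+n≤o⇒n≤o _ p+d′≤n)) n<d))

  seedArray-ok : Triple (λ s → Frame s × R≡0 s) seedArray (runPhaseTime n + scanPhaseTime n)
    (λ s → ∀ i → 1 ≤ i → i ≤ n → HasSeed (A ∘ suc) i (arrs s 1 i) ×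
      (∀ m → 1 ≤ m → m ≤ i → HasSeed (A ∘ suc) i m → arrs s 1 i ≤ m))
  seedArray-ok = triple-weaken post (triple-seq runPhase-ok scanPhase-ok)
    where
    post : ∀ s → Scans s × ⟦ scanRowTest ⟧ᵗ s ≡ false → ∀ i → 1 ≤ i → i ≤ n →
      HasSeed (A ∘ suc) i (arrs s 1 i) ×
      (∀ m → 1 ≤ m → m ≤ i → HasSeed (A ∘ suc) i m → arrs s 1 i ≤ m)
    post s (((refl , refl) , p≤n , inv) , test) i 1≤i i≤n =
      -- The whole prefix is a seed of itself, so length `i` turns the conditional `IsSeed` into the
      -- existence of a seed of the recorded length.
      proj₂ (proj₂ (seed 1≤i ≤-refl (hasSeed-self 1≤i))) ,
      λ m 1≤m m≤i has → proj₁ (proj₂ (seed 1≤m m≤i has))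
      where
      open Tables.Inv inv
      seed : ∀ {m} → 1 ≤ m → m ≤ i → Tables.IsSeed (regs s 0) (letters s) i m (arrs s 1 i)
      seed {m} 1≤m m≤i = subst (λ j → Tables.IsSeed (regs s 0) (letters s) j m (arrs s 1 j)) (m∸n+n≡m m≤i)
        (seeds 1≤m (≤-trans (≤-reflexive (m∸n+n≡m m≤i)) i≤n)
          (inj₁ (≤-trans (∸-monoʳ-< 1≤m m≤i) (≤-trans i≤n (<ᵇ-false test)))))

-- The bounds

O-+ : ∀ {g f h} → O g f → O g h → O g (λ n → f n + h n)
O-+ {g} (c , n₀ , f≤) (d , n₁ , h≤) = c + d , n₀ + n₁ , λ n n≥ →
  ≤-trans (+-mono-≤ (f≤ n (m+n≤o⇒m≤o n₀ n≥)) (h≤ n (m+n≤o⇒n≤o n₀ n≥)))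
    (≤-reflexive (sym (*-distribʳ-+ (g n) c d)))

O-refl : ∀ g → O g g
O-refl g = 1 , 0 , λ n _ → ≤-reflexive (sym (+-identityʳ (g n)))

O-const : ∀ {g : ℕ → ℕ} n₀ → (∀ n → n₀ ≤ n → 1 ≤ g n) → ∀ a → O g (λ _ → a)
O-const n₀ 1≤g a = a , n₀ , λ n n₀≤n →
  ≤-trans (≤-reflexive (sym (*-identityʳ a))) (*-monoʳ-≤ a (1≤g n n₀≤n))

O-*-const : ∀ {g f} a → O g f → O g (λ n → f n * a)
O-*-const {g} {f} a (c , n₀ , f≤) = a * c , n₀ , λ n n₀≤n →
  ≤-trans (*-monoˡ-≤ a (f≤ n n₀≤n)) (≤-reflexive (swap c (g n) a))
  where
  swap : ∀ x y z → x * y * z ≡ z * x * y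
  swap = solve-∀

linear-const : ∀ a → O (λ n → n) (λ _ → a)
linear-const = O-const 1 λ _ 1≤n → 1≤n

quadratic-const : ∀ a → O (λ n → n ^ 2) (λ _ → a)
quadratic-const = O-const 1 λ n 1≤n → *-mono-≤ 1≤n (≤-trans 1≤n (≤-reflexive (sym (*-identityʳ n))))

n*-linear : ∀ {f} → O (λ n → n) f → O (λ n → n ^ 2) (λ n → n * f n)
n*-linear (c , n₀ , f≤) = c , n₀ , λ n n₀≤n → ≤-trans (*-monoʳ-≤ n (f≤ n n₀≤n)) (≤-reflexive (swap n c))
  where
  swap : ∀ n c → n * (c * n) ≡ c * (n * (n * 1))
  swap = solve-∀

suc-linear : O (λ n → n) suc
suc-linear = O-+ (linear-const 1) (O-refl _)

rowTime-linear : ∀ a b {v} c e → O (λ n → n) v → O (λ n → n) (λ n → rowTime a b (v n) c e)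
rowTime-linear a b c e v∈ = O-+ (linear-const a)
  (O-+ (O-+ (linear-const b) (O-*-const (b + c) v∈)) (linear-const e))

phaseTime-quadratic : ∀ a b {f} → O (λ n → n) f → O (λ n → n ^ 2) (λ n → phaseTime a b n (f n))
phaseTime-quadratic a b f∈ = O-+ (quadratic-const a) (O-+ (quadratic-const b)
  (n*-linear (O-+ (linear-const b) f∈)))

time-quadratic : O (λ n → n ^ 2) (λ n → runPhaseTime n + scanPhaseTime n)
time-quadratic = O-+ {f = runPhaseTime} {scanPhaseTime}
  (phaseTime-quadratic (time runStart) (costᵗ runRowTest)
    (rowTime-linear (time runInit) (costᵗ runTest) (time runStep) (time runNext) suc-linear))
  (phaseTime-quadratic (time scanStart) (costᵗ scanRowTest)
    (rowTime-linear (time scanInit) (costᵗ scanTest) (time scanStep) (time scanNext)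
      (O-+ suc-linear suc-linear)))

n<2^n : ∀ n → n < 2 ^ n
n<2^n zero    = ≤-refl
n<2^n (suc n) = ≤-trans (+-mono-≤ (m^n>0 2 n) (n<2^n n))
  (≤-reflexive (cong (2 ^ n +_) (sym (+-identityʳ (2 ^ n)))))

n<2^1+log₂n : ∀ n → n < 2 ^ suc ⌊log₂ n ⌋
n<2^1+log₂n n = ≰⇒> λ 2^≤n →
  n≮n ⌊log₂ n ⌋ (subst (_≤ ⌊log₂ n ⌋) (⌊log₂[2^n]⌋≡n (suc ⌊log₂ n ⌋)) (⌊log₂⌋-mono-≤ 2^≤n))

-- Registers and array entries stay below 1 + n or are letters.
bound : ℕ → ℕ → ℕ
bound σ n = 2 + σ + n

-- `bound σ n` is below `2 ^ (2 + σ) * 2 ^ suc ⌊log₂ n ⌋`; the factor `k` makes room for its `k`-th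
-- power. With `σ` and `k` constant this is logarithmic.
wordSize : ℕ → ℕ → ℕ → ℕ
wordSize k σ n = (2 + σ + suc ⌊log₂ n ⌋) * k

wordSize-logarithmic : ∀ k σ → O ⌊log₂_⌋ (wordSize k σ)
wordSize-logarithmic k σ = O-*-const k (O-+ (log-const (2 + σ)) (O-+ (log-const 1) (O-refl _)))
  where
  log-const : ∀ a → O ⌊log₂_⌋ (λ _ → a)
  -- From `n = 2` on the logarithm is at least 1.
  log-const = O-const 2 λ _ → ⌊log₂⌋-mono-≤

bound^k<2^wordSize : ∀ k .{{_ : NonZero k}} σ n → bound σ n ^ k < 2 ^ wordSize k σ n
bound^k<2^wordSize k σ n = subst (bound σ n ^ k <_) (^-*-assoc 2 (2 + σ + suc ⌊log₂ n ⌋) k)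
  (^-monoˡ-< k (begin-strict
    2 + σ + n                              <⟨ ≤-reflexive (sym (+-suc (2 + σ) n)) ⟩
    2 + σ + suc n                          ≡⟨ +-comm (2 + σ) (suc n) ⟩
    suc n + (2 + σ)                        ≤⟨ +-monoʳ-≤ (suc n) (m≤m*n (2 + σ) (suc n)) ⟩
    suc (2 + σ) * suc n                    ≤⟨ *-mono-≤ (n<2^n (2 + σ)) (n<2^1+log₂n n) ⟩
    2 ^ (2 + σ) * 2 ^ suc ⌊log₂ n ⌋         ≡⟨ ^-distribˡ-+-* 2 (2 + σ) (suc ⌊log₂ n ⌋) ⟨
    2 ^ (2 + σ + suc ⌊log₂ n ⌋)             ∎))
  where open ≤-Reasoning

letter≤ : ∀ {σ} (u : Word σ) j → letter u j ≤ σ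
letter≤ []      _       = z≤n
letter≤ (a ∷ _) zero    = <⇒≤ (toℕ<n a)
letter≤ (_ ∷ u) (suc j) = letter≤ u j

module _ {σ : ℕ} (w B : ℕ) (u : Word σ) (2≤B : 2 ≤ B) (σ≤B : σ ≤ B) (n<B : length u < B)
  (B^K<2^w : B ^ K < 2 ^ w) where
  open RAM w K B 2≤B B^K<2^w using (Bounded)
  open Correctness w B (length u) (nth (0 ∷ map toℕ u)) 2≤B n<B B^K<2^w using (seedArray-ok)

  input-bounded : Bounded (wordInput u)
  input-bounded =
    (λ x → update-elim (_≤ B) (λ _ → 0) 0 (length u) x (λ _ → <⇒≤ n<B) (λ _ → z≤n)) ,
    (λ a i → update-elim (λ A → A i ≤ B) (λ _ _ → 0) 0 (nth (0 ∷ map toℕ u)) a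
      (λ _ → entry i) (λ _ → z≤n))
    where
    entry : ∀ i → nth (0 ∷ map toℕ u) i ≤ B
    entry zero    = z≤n
    entry (suc i) = ≤-trans (letter≤ u i) σ≤B

  seedArray-runs : ∃[ t ] ∃[ s ] (w ⊢ seedArray , wordInput u ⇓[ t ] s ×
    t ≤ runPhaseTime (length u) + scanPhaseTime (length u) × HoldsSeedArray u s)
  seedArray-runs =
    let t , s , r , t≤ , _ , post = seedArray-ok (wordInput u) input-bounded ((refl , refl) , λ _ → refl)
    in t , s , r , t≤ , λ i 1≤i i≤n →
      let has , least = post i 1≤i i≤n in
      hasSeed⇒seed u i≤n has ,
      λ x seed → let 1≤m , m≤i , has′ = seed⇒hasSeed u 1≤i i≤n seed in least (length x) 1≤m m≤i has′

theorem5 : (σ : ℕ) → ComputableInTime (λ n → n ^ 2) length (wordInput {σ}) HoldsSeedArray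
theorem5 σ = seedArray , (λ n → runPhaseTime n + scanPhaseTime n) , wordSize K σ ,
  time-quadratic , wordSize-logarithmic K σ , λ u → seedArray-runs (wordSize K σ (length u)) (bound σ (length u)) u (s≤s (s≤s z≤n))
    (≤-trans (m≤n+m σ 2) (m≤m+n (2 + σ) _)) (s≤s (m≤n⇒m≤1+n (m≤n+m (length u) σ)))
    (bound^k<2^wordSize K σ (length u))
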